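{- Let $k\ge 1$ and let $P$ be the element of $St_{2^k}$ that has $1,\dots,k$ in the first column. Then $$D^{P}(x,t)=\frac{1-x}{1-x+(x-1)\frac{t}{k!}+\sum_{n\ge 2}\frac{((x-1)t)^n}{(kn)!}}$$ and $$A^{P}(t)=\frac{1}{1-\frac{t}{k!}+\sum_{n\ge 2}\frac{(-t)^n}{(kn)!}}.$$
   Context: $\mathcal{F}_{n,k}$ is the set of all fillings $F$ of the $k\times n$ rectangular array ($k$ rows, $n$ columns) with the integers $1,\dots,kn$, each used once, such that the elements in each column increase from bottom to top. $St_{2^k}$ is the set of standard tableaux of shape $2^k$, i.e. the elements of $\mathcal{F}_{2,k}$ whose entries also increase in each row from left to right. For a filling of a $k\times n$ array by distinct positive integers with columns increasing from bottom to top, $\mathrm{red}(F)\in\mathcal{F}_{n,k}$ is obtained by replacing the $i$-th smallest entry by $i$. $F[i,i+1]$ is the $k\times 2$ filling formed by columns $i$ and $i+1$ of $F$. For $P\in\mathcal{F}_{2,k}$, $F\in\mathcal{F}_{n,k}$ has a $P$-match starting at position $i$ ($1\le i\le n-1$) if $\mathrm{red}(F[i,i+1])=P$; $P\text{ -mch}(F)$ is the number of $P$-matches in $F$, and $A^{P}_{n,k}$ is the number of $F\in\mathcal{F}_{n,k}$ with no $P$-matches. Define $$D^{P}(x,t)=1+\sum_{n\ge 1}\frac{t^n}{(kn)!}\sum_{F\in\mathcal{F}_{n,k}}x^{P\text{ -mch}(F)},\qquad A^{P}(t)=D^{P}(0,t)=1+\sum_{n\ge1}\frac{A^{P}_{n,k}t^n}{(kn)!}.$$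 The identities are of formal power series in $t$ (with coefficients in $\mathbb{Q}(x)$ for the first). -}

module Defs where

open import Algebra.Bundles using (Ring)
open import Algebra.Bundles.Raw using (RawRing)
open import Algebra.Definitions using (Invertible)
open import Data.Empty using (⊥-elim)
open import Data.Fin.Base using (Fin; inject₁)
open import Data.Integer.Base using (+_)
open import Data.List.Base as List using (List; []; _∷_)
import Data.List.Relation.Unary.All as All
open import Data.List.Relation.Unary.Unique.Propositional using (Unique)
import Data.List.Relation.Unary.Unique.DecPropositional as DecUnique
open import Data.Nat.Base as ℕ using (ℕ; zero; suc; _!)
open import Data.Nat.Properties as ℕₚ using (_!≢0)
open import Data.Product.Base using (_×_; _,_)
open import Data.Rational.Base as ℚ using (ℚ; 0ℚ; 1ℚ)
import Data.Rational.Properties as ℚₚ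
open import Data.Vec.Base as Vec using (Vec; []; _∷_)
import Data.Vec.Properties as Vecₚ
import Data.Vec.Relation.Unary.All as VecAll
open import Data.Vec.Relation.Unary.Linked as Linked using (Linked)
open import Function.Base using (_∘_)
open import Level using (0ℓ)
open import Relation.Binary.Definitions using (DecidableEquality)
open import Relation.Binary.PropositionalEquality
  using (_≡_; _≢_; refl; sym; trans; cong; module ≡-Reasoning)
open import Relation.Nullary using (¬_; yes; no)
open import Relation.Nullary.Decidable using (_×-dec_)
open import Relation.Unary using (Decidable)

------------------------------------------------------------------------
-- Fillings

-- A k × n array is the vector of its n columns, from left to right; each
-- column lists its k entries from bottom to top.

Array : ℕ → ℕ → Set
Array n k = Vec (Vec ℕ k) n

_≟_ : ∀ {n k} → DecidableEquality (Array n k)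
_≟_ = Vecₚ.≡-dec (Vecₚ.≡-dec ℕₚ._≟_)

entries : ∀ {n k} → Array n k → List ℕ
entries F = Vec.toList (Vec.concat F)

Increasing : ∀ {n} → Vec ℕ n → Set
Increasing = Linked ℕ._<_

-- There are exactly k n cells, so distinct entries in the range 1, …, k n
-- means that each of these integers is used once.

IsFilling : ∀ {n k} → Array n k → Set
IsFilling {n} {k} F =
  All.All (λ v → 1 ℕ.≤ v × v ℕ.≤ k ℕ.* n) (entries F) ×
  Unique (entries F) ×
  VecAll.All Increasing F

isFilling? : ∀ {n k} → Decidable (IsFilling {n} {k})
isFilling? {n} {k} F =
  All.all? (λ v → (1 ℕₚ.≤? v) ×-dec (v ℕₚ.≤? k ℕ.* n)) (entries F) ×-dec
  DecUnique.unique? ℕₚ._≟_ (entries F) ×-dec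
  VecAll.all? (Linked.linked? ℕₚ._<?_) F

vectorsOver : {A : Set} → List A → ∀ n → List (Vec A n)
vectorsOver as zero    = [] ∷ []
vectorsOver as (suc n) = List.cartesianProductWith _∷_ as (vectorsOver as n)

-- Every filling has its entries in 1, …, k n, and so occurs here, once.

𝓕 : ∀ n k → List (Array n k)
𝓕 n k = List.filter isFilling?
  (vectorsOver (vectorsOver (List.applyUpTo suc (k ℕ.* n)) k) n)

IsStandardTableau₂ : ∀ {k} → Array 2 k → Set
IsStandardTableau₂ P = IsFilling P × VecAll.All Increasing (Vec.transpose P)

rank : List ℕ → ℕ → ℕ
rank vs v = List.length (List.filter (ℕₚ._≤? v) vs)

red : ∀ {n k} → Array n k → Array n k
red F = Vec.map (Vec.map (rank (entries F))) F

_[_,+1] : ∀ {n k} → Array (suc n) k → Fin n → Array 2 k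
F [ i ,+1] = Vec.lookup F (inject₁ i) ∷ Vec.lookup F (Fin.suc i) ∷ []

HasMatchAt : ∀ {n k} → Array 2 k → Array (suc n) k → Fin n → Set
HasMatchAt P F i = red (F [ i ,+1]) ≡ P

mch : ∀ {n k} → Array 2 k → Array n k → ℕ
mch {zero}  P F = 0
mch {suc n} P F = List.length (List.filter hasMatchAt? (List.allFin n))
  where
  hasMatchAt? : Decidable (HasMatchAt P F)
  hasMatchAt? i = red (F [ i ,+1]) ≟ P

#avoiding : ∀ n {k} → Array 2 k → ℕ
#avoiding n {k} P = List.length (List.filter (λ F → mch P F ℕₚ.≟ 0) (𝓕 n k))

infix 9 _/_!

_/_! : ℕ → ℕ → ℚ
a / n ! = (+ a ℚ./ (n !)) {{n !≢0}}

------------------------------------------------------------------------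
-- Formal power series in t

module PowerSeries {c ℓ} (R : RawRing c ℓ) where
  open RawRing R

  Series : Set c
  Series = ℕ → Carrier

  infix 4 _≋_
  _≋_ : Series → Series → Set ℓ
  f ≋ g = ∀ n → f n ≈ g n

  const : Carrier → Series
  const a zero    = a
  const a (suc n) = 0#

  -- The Cauchy product, by f g = f₀ g + t ((f - f₀) / t) g.

  infixl 7 _⊛_
  _⊛_ : Series → Series → Series
  (f ⊛ g) zero    = f 0 * g 0
  (f ⊛ g) (suc n) = f 0 * g (suc n) + ((f ∘ suc) ⊛ g) n

  Unit : Carrier → Set _
  Unit = Invertible _≈_ 1# _*_

  -- Long division: for q₀ = f₀ / g₀,  f / g = q₀ + t (((f - q₀ g) / t) / g).

  infixl 7 _÷_[_]
  _÷_[_] : Series → (g : Series) → Unit (g 0) → Series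
  (f ÷ g [ u , _ ]) zero            = f 0 * u
  (f ÷ g [ inv@(u , _) ]) (suc n) =
    ((λ m → f (suc m) + (- (f 0 * u * g (suc m)))) ÷ g [ inv ]) n

module _ {c ℓ} (R : Ring c ℓ) where
  open Ring R
  open PowerSeries rawRing

  ÷-⊛ : ∀ f g (inv : Unit (g 0)) → (f ÷ g [ inv ]) ⊛ g ≋ f
  ÷-⊛ f g (u , ug≈1 , _) zero =
    Ring.trans R (*-assoc (f 0) u (g 0))
      (Ring.trans R (*-congˡ ug≈1) (*-identityʳ (f 0)))
  ÷-⊛ f g inv@(u , _) (suc n) =
    Ring.trans R (+-congˡ (÷-⊛ _ g inv n))
      (Ring.trans R (+-congˡ (+-comm _ _))
        (Ring.trans R (Ring.sym R (+-assoc _ _ _))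
          (Ring.trans R (+-congʳ (-‿inverseʳ _)) (+-identityˡ _))))

------------------------------------------------------------------------
-- The polynomials ℚ[x]

-- Lists of coefficients, constant term first; trailing zeros are allowed.

ℚ[x] : Set
ℚ[x] = List ℚ

module Poly where

  coeff : ℚ[x] → ℕ → ℚ
  coeff []      i       = 0ℚ
  coeff (a ∷ p) zero    = a
  coeff (a ∷ p) (suc i) = coeff p i

  infix 4 _≈_ _≉_
  _≈_ _≉_ : ℚ[x] → ℚ[x] → Set
  p ≈ q = ∀ i → coeff p i ≡ coeff q i
  p ≉ q = ¬ (p ≈ q)

  infixl 6 _+_
  _+_ : ℚ[x] → ℚ[x] → ℚ[x]
  []      + q       = q
  (a ∷ p) + []      = a ∷ p
  (a ∷ p) + (b ∷ q) = (a ℚ.+ b) ∷ (p + q)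

  -_ : ℚ[x] → ℚ[x]
  - p = List.map (λ a → ℚ.- a) p

  infixl 7 _*_
  _*_ : ℚ[x] → ℚ[x] → ℚ[x]
  []      * q = []
  (a ∷ p) * q = List.map (a ℚ.*_) q + (0ℚ ∷ p * q)

  coeff-+ : ∀ p q i → coeff (p + q) i ≡ coeff p i ℚ.+ coeff q i
  coeff-+ []      q       i       = sym (ℚₚ.+-identityˡ (coeff q i))
  coeff-+ (a ∷ p) []      i       = sym (ℚₚ.+-identityʳ (coeff (a ∷ p) i))
  coeff-+ (a ∷ p) (b ∷ q) zero    = refl
  coeff-+ (a ∷ p) (b ∷ q) (suc i) = coeff-+ p q i

  coeff-scale : ∀ a p i → coeff (List.map (a ℚ.*_) p) i ≡ a ℚ.* coeff p i
  coeff-scale a []      i       = sym (ℚₚ.*-zeroʳ a)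
  coeff-scale a (b ∷ p) zero    = refl
  coeff-scale a (b ∷ p) (suc i) = coeff-scale a p i

  coeff-* : ∀ a p q i →
            coeff ((a ∷ p) * q) i ≡ a ℚ.* coeff q i ℚ.+ coeff (0ℚ ∷ p * q) i
  coeff-* a p q i =
    trans (coeff-+ (List.map (a ℚ.*_) q) (0ℚ ∷ p * q) i)
          (cong (ℚ._+ coeff (0ℚ ∷ p * q) i) (coeff-scale a q i))

  *-∷ʳ : ∀ p b q i →
         coeff (p * (b ∷ q)) (suc i) ≡ coeff p (suc i) ℚ.* b ℚ.+ coeff (p * q) i
  *-∷ʳ []      b q i = sym (trans (ℚₚ.+-identityʳ _) (ℚₚ.*-zeroˡ b))
  *-∷ʳ (a ∷ p) b q i = begin
    coeff ((a ∷ p) * (b ∷ q)) (suc i)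
      ≡⟨ coeff-* a p (b ∷ q) (suc i) ⟩
    a ℚ.* coeff q i ℚ.+ coeff (p * (b ∷ q)) i
      ≡⟨ cong (a ℚ.* coeff q i ℚ.+_) (tail i) ⟩
    a ℚ.* coeff q i ℚ.+ (coeff p i ℚ.* b ℚ.+ coeff (0ℚ ∷ p * q) i)
      ≡⟨ ℚₚ.+-assoc (a ℚ.* coeff q i) (coeff p i ℚ.* b) _ ⟨
    (a ℚ.* coeff q i ℚ.+ coeff p i ℚ.* b) ℚ.+ coeff (0ℚ ∷ p * q) i
      ≡⟨ cong (ℚ._+ coeff (0ℚ ∷ p * q) i) (ℚₚ.+-comm (a ℚ.* coeff q i) _) ⟩
    (coeff p i ℚ.* b ℚ.+ a ℚ.* coeff q i) ℚ.+ coeff (0ℚ ∷ p * q) i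
      ≡⟨ ℚₚ.+-assoc (coeff p i ℚ.* b) (a ℚ.* coeff q i) _ ⟩
    coeff p i ℚ.* b ℚ.+ (a ℚ.* coeff q i ℚ.+ coeff (0ℚ ∷ p * q) i)
      ≡⟨ cong (coeff p i ℚ.* b ℚ.+_) (coeff-* a p q i) ⟨
    coeff p i ℚ.* b ℚ.+ coeff ((a ∷ p) * q) i ∎
    where
    open ≡-Reasoning
    head₀ : ∀ p → coeff (p * (b ∷ q)) 0 ≡ coeff p 0 ℚ.* b
    head₀ []      = sym (ℚₚ.*-zeroˡ b)
    head₀ (a ∷ p) = ℚₚ.+-identityʳ (a ℚ.* b)
    tail : ∀ i → coeff (p * (b ∷ q)) i ≡ coeff p i ℚ.* b ℚ.+ coeff (0ℚ ∷ p * q) i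
    tail zero    = trans (head₀ p) (sym (ℚₚ.+-identityʳ _))
    tail (suc i) = *-∷ʳ p b q i

  cancelˡ : ∀ {a b} → a ≢ 0ℚ → a ℚ.* b ≡ 0ℚ → b ≡ 0ℚ
  cancelˡ {a} {b} a≢0 ab≡0 = begin
    b                      ≡⟨ ℚₚ.*-identityˡ b ⟨
    1ℚ ℚ.* b               ≡⟨ cong (ℚ._* b) (ℚₚ.*-inverseˡ a) ⟨
    (ℚ.1/ a ℚ.* a) ℚ.* b   ≡⟨ ℚₚ.*-assoc (ℚ.1/ a) a b ⟩
    ℚ.1/ a ℚ.* (a ℚ.* b)   ≡⟨ cong (ℚ.1/ a ℚ.*_) ab≡0 ⟩
    ℚ.1/ a ℚ.* 0ℚ          ≡⟨ ℚₚ.*-zeroʳ (ℚ.1/ a) ⟩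
    0ℚ                     ∎
    where
    open ≡-Reasoning
    instance _ = ℚ.≢-nonZero a≢0

  *≈0⇒≈0ʳ : ∀ p q → p ≉ [] → p * q ≈ [] → q ≈ []
  *≈0⇒≈0ʳ []      q       p≉0 pq≈0 = ⊥-elim (p≉0 (λ _ → refl))
  *≈0⇒≈0ʳ (a ∷ p) q       p≉0 pq≈0 with a ℚₚ.≟ 0ℚ
  *≈0⇒≈0ʳ (a ∷ p) q       p≉0 pq≈0 | yes refl =
    *≈0⇒≈0ʳ p q (λ p≈0 → p≉0 λ { zero → refl ; (suc i) → p≈0 i })
      (λ i → trans (sym (shifted i)) (pq≈0 (suc i)))
    where
    shifted : ∀ i → coeff ((0ℚ ∷ p) * q) (suc i) ≡ coeff (p * q) i
    shifted i = trans (coeff-* 0ℚ p q (suc i))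
      (trans (cong (ℚ._+ coeff (p * q) i) (ℚₚ.*-zeroˡ (coeff q (suc i))))
             (ℚₚ.+-identityˡ _))
  *≈0⇒≈0ʳ (a ∷ p) []      p≉0 pq≈0 | no a≢0 = λ _ → refl
  *≈0⇒≈0ʳ (a ∷ p) (b ∷ q) p≉0 pq≈0 | no a≢0 = λ
    { zero    → b≡0
    ; (suc i) → *≈0⇒≈0ʳ (a ∷ p) q p≉0
        (λ j → trans (sym (shifted j)) (pq≈0 (suc j))) i }
    where
    b≡0 : b ≡ 0ℚ
    b≡0 = cancelˡ a≢0 (trans (sym (ℚₚ.+-identityʳ (a ℚ.* b))) (pq≈0 0))
    shifted : ∀ j → coeff ((a ∷ p) * (b ∷ q)) (suc j) ≡ coeff ((a ∷ p) * q) j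
    shifted j = trans (*-∷ʳ (a ∷ p) b q j)
      (trans (cong (λ c → coeff p j ℚ.* c ℚ.+ coeff ((a ∷ p) * q) j) b≡0)
        (trans (cong (ℚ._+ coeff ((a ∷ p) * q) j) (ℚₚ.*-zeroʳ (coeff p j)))
               (ℚₚ.+-identityˡ _)))

  *-≉0 : ∀ p q → p ≉ [] → q ≉ [] → p * q ≉ []
  *-≉0 p q p≉0 q≉0 pq≈0 = q≉0 (*≈0⇒≈0ʳ p q p≉0 pq≈0)

------------------------------------------------------------------------
-- The rational functions ℚ(x)

record ℚ⟨x⟩ : Set where
  constructor frac
  field
    num   : ℚ[x]
    den   : ℚ[x]
    den≉0 : den Poly.≉ []

module Rat where
  open ℚ⟨x⟩

  infix 4 _≈_
  _≈_ : ℚ⟨x⟩ → ℚ⟨x⟩ → Set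
  r ≈ s = num r Poly.* den s Poly.≈ num s Poly.* den r

  fromPoly : ℚ[x] → ℚ⟨x⟩
  fromPoly p = frac p (1ℚ ∷ []) (λ 1≈0 → 1≢0 (1≈0 0))
    where
    1≢0 : 1ℚ ≢ 0ℚ
    1≢0 ()

  infixl 6 _+_ _-_
  infixl 7 _*_

  _+_ _*_ : ℚ⟨x⟩ → ℚ⟨x⟩ → ℚ⟨x⟩
  r + s = frac (num r Poly.* den s Poly.+ num s Poly.* den r)
               (den r Poly.* den s) (Poly.*-≉0 (den r) (den s) (den≉0 r) (den≉0 s))
  r * s = frac (num r Poly.* num s)
               (den r Poly.* den s) (Poly.*-≉0 (den r) (den s) (den≉0 r) (den≉0 s))

  -_ : ℚ⟨x⟩ → ℚ⟨x⟩
  -_ r = frac (Poly.- num r) (den r) (den≉0 r)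

  _-_ : ℚ⟨x⟩ → ℚ⟨x⟩ → ℚ⟨x⟩
  r - s = r + (-_ s)

  0# 1# X : ℚ⟨x⟩
  0# = fromPoly []
  1# = fromPoly (1ℚ ∷ [])
  X  = fromPoly (0ℚ ∷ 1ℚ ∷ [])

  C : ℚ → ℚ⟨x⟩
  C a = fromPoly (a ∷ [])

  rawRing : RawRing 0ℓ 0ℓ
  rawRing = record
    { Carrier = ℚ⟨x⟩ ; _≈_ = _≈_ ; _+_ = _+_ ; _*_ = _*_ ; -_ = -_ ; 0# = 0# ; 1# = 1# }

  open import Algebra.Definitions.RawSemiring (RawRing.rawSemiring rawRing)
    using (_^_) public

  sum : List ℚ⟨x⟩ → ℚ⟨x⟩
  sum = List.foldr _+_ 0#

------------------------------------------------------------------------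
-- The generating functions

module ℚ⟨x⟩⟦t⟧ = PowerSeries Rat.rawRing
module ℚ⟦t⟧ = PowerSeries ℚ.+-*-rawRing

module _ {k : ℕ} (P : Array 2 k) where
  open Rat

  D : ℚ⟨x⟩⟦t⟧.Series
  D zero      = 1#
  D n@(suc _) = C (1 / (k ℕ.* n) !) * sum (List.map (λ F → X ^ mch P F) (𝓕 n k))

  A : ℚ⟦t⟧.Series
  A zero      = 1ℚ
  A n@(suc _) = #avoiding n P / (k ℕ.* n) !

module _ (k : ℕ) where

  D-denominator : ℚ⟨x⟩⟦t⟧.Series
  D-denominator 0               = 1# - X
    where open Rat
  D-denominator 1               = (X - 1#) * C (1 / k !)
    where open Rat
  D-denominator n@(suc (suc _)) = (X - 1#) ^ n * C (1 / (k ℕ.* n) !)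
    where open Rat

  A-denominator : ℚ⟦t⟧.Series
  A-denominator 0               = 1ℚ
  A-denominator 1               = ℚ.- (1 / k !)
  A-denominator n@(suc (suc _)) = (ℚ.- 1ℚ) ^ n ℚ.* (1 / (k ℕ.* n) !)
    where
    open import Algebra.Definitions.RawSemiring (RawRing.rawSemiring ℚ.+-*-rawRing)
      using (_^_)

  1-X-unit : ℚ⟨x⟩⟦t⟧.Unit (D-denominator 0)
  1-X-unit = frac (1ℚ ∷ []) (1ℚ ∷ (ℚ.- 1ℚ) ∷ []) (λ 1-x≈0 → 1≢0 (1-x≈0 0))
           , (λ { 0 → refl ; 1 → refl ; 2 → refl ; (suc (suc (suc _))) → refl })
           , (λ { 0 → refl ; 1 → refl ; 2 → refl ; (suc (suc (suc _))) → refl })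
    where
    1≢0 : 1ℚ ≢ 0ℚ
    1≢0 ()

  1-unit : ℚ⟦t⟧.Unit (A-denominator 0)
  1-unit = 1ℚ , refl , refl

{-# OPTIONS --safe #-}
module Submission where

-- Columns of increasing entries are subsets, so a filling by a set S of k n
-- numbers is an ordered partition of S into k-subsets, and a P-match is a pair
-- of adjacent columns C, C′ with every entry of C below every entry of C′,
-- written C < C′ (match⇒before, before⇒match).
--
-- Put x = 1 + y and let d(S) be the sum of x to the number of matches over all
-- the fillings by S.  A pair of adjacent columns contributes the factor 1 + y
-- if it is a match and 1 otherwise.  Expand these factors from left to right up
-- to the first choice of the summand 1, or to the end: the columns up to there
-- form a chain C₁ < … < Cⱼ, weighted by y to the power j - 1, and the columns
-- after it form an arbitrary filling.  A chain is determined by the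
-- union of its columns, which can be any subset of size k j.  Hence
--
--   d(S) = sum over j ≥ 1 of y^(j-1) (sum over U ⊆ S with |U| = k j of d(S - U)).
--
-- Two steps carry this: weightAfter-suc expands the factor of the first pair
-- of columns, and ∑-splits-merge replaces a set U followed by a column C with
-- U < C by their union; chain-suc combines them.  By strong induction on n,
-- d(S) = (k n)! qₙ, where q solves qₙ₊₁ = sum over j ≥ 1 of
-- y^(j-1) qₙ₊₁₋ⱼ / (k j)!, as binomial(k n, k j) (k j)! (k (n - j))! = (k n)!
-- (chain-value, weight-value).  Long division by the denominators of the theorem
-- produces this recurrence (quotient-value).
--
-- The argument holds in any commutative ring with a sequence of inverses of
-- the factorials.  The first identity is the case of ℚ(x) with x = X, the
-- second that of ℚ with x = 0, where 0 to the number of matches is 1 on the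
-- fillings without matches and 0 on the others.  For this, ℚ(x) is shown to be
-- a commutative ring: coefficients embed ℚ[x] into the power series, and
-- fractions satisfy the ring laws by cross multiplication.
open import Algebra.Bundles using (CommutativeRing)
open import Algebra.Bundles.Raw using (RawRing)
open import Algebra.Morphism.Structures using (IsRingMonomorphism)
import Algebra.Morphism.RingMonomorphism as RingMonomorphism
open import Data.Bool.Base using (true; false; if_then_else_)
open import Data.Empty using (⊥-elim)
open import Data.Fin.Base as Fin using (Fin)
import Data.Fin.Properties as Finₚ
import Data.Integer.Base as ℤ
import Data.Integer.Properties as ℤₚ
open import Data.List.Base as List
  using (List; []; _∷_; _++_; map; concatMap; length; filter; applyUpTo; foldr)
import Data.List.Properties as Listₚ
open import Data.List.Membership.Propositional using (_∈_; find)
open import Data.List.Membership.Propositional.Properties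
  using ( ∈-++⁺ˡ; ∈-++⁺ʳ; ∈-++⁻; ∈-map⁺; ∈-map⁻; ∈-concat⁺′; ∈-concatMap⁻
        ; ∈-filter⁺; ∈-filter⁻; ∈-applyUpTo⁺; ∈-applyUpTo⁻; ∈-cartesianProductWith⁺)
open import Data.List.Membership.Propositional.Properties.WithK using (unique∧set⇒bag)
open import Data.List.Relation.Binary.BagAndSetEquality using (∼bag⇒↭)
open import Data.List.Relation.Binary.Disjoint.Propositional using (Disjoint)
open import Data.List.Relation.Binary.Permutation.Propositional as Perm
  using (_↭_; ↭-refl; ↭-sym; ↭-trans; ↭⇒↭ₛ)
open import Data.List.Relation.Binary.Permutation.Propositional.Properties
  using (All-resp-↭; ∈-resp-↭; ↭-length; shift)
open import Data.List.Relation.Binary.Permutation.Setoid.Properties using (Unique-resp-↭)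
open import Data.List.Relation.Unary.All as All using (All; []; _∷_)
import Data.List.Relation.Unary.All.Properties as Allₚ
open import Data.List.Relation.Unary.AllPairs as AllPairs using (AllPairs; []; _∷_)
import Data.List.Relation.Unary.AllPairs.Properties as AllPairsₚ
open import Data.List.Relation.Unary.Any using (here; there)
open import Data.List.Relation.Unary.Unique.Propositional using (Unique)
import Data.List.Relation.Unary.Unique.Propositional.Properties as Uniqueₚ
open import Data.Nat using (ℕ; suc; _≥_)
open import Data.Nat.Base as ℕ using (zero; _≤_; _<_; _!; z≤n; s≤s; NonZero)
open import Data.Nat.Combinatorics
  using (nCk≡n!/k![n-k]!; k![n∸k]!∣n!; nCk+nC[k+1]≡[n+1]C[k+1])
  renaming (_C_ to _choose_)
open import Data.Nat.DivMod using (m/n*n≡m)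
import Data.Nat.Properties as ℕₚ
open import Data.Fin using (toℕ)
open import Data.Product using (_×_)
open import Data.Product.Base using (_,_; proj₁; proj₂; ∃; -,_)
open import Data.Rational using (1ℚ)
open import Data.Rational.Base as ℚ using (0ℚ; toℚᵘ)
import Data.Rational.Properties as ℚₚ
open import Data.Rational.Unnormalised.Base as ℚᵘ using (mkℚᵘ; *≡*)
import Data.Rational.Unnormalised.Properties as ℚᵘₚ
open import Data.Sum.Base using (inj₁; inj₂)
open import Data.Vec using (head; tabulate)
open import Data.Vec.Base as Vec using (Vec; []; _∷_; toList)
import Data.Vec.Properties as Vecₚ
open import Data.Vec.Membership.Propositional.Properties using (∈-toList⁺; ∈-tabulate⁺)
open import Data.Vec.Relation.Unary.All as VecAll using ([]; _∷_)
import Data.Vec.Relation.Unary.All.Properties as VecAllₚ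
open import Data.Vec.Relation.Unary.Linked using ([]; [-]; _∷_)
import Data.Vec.Relation.Unary.Linked.Properties as Linkedₚ
open import Function.Base using (_∘_; case_of_)
open import Function.Bundles using (_⇔_; mk⇔)
open import Level using (0ℓ)
open import Relation.Binary.PropositionalEquality as ≡ using (_≡_; _≢_)
open import Relation.Nullary using (¬_; Dec; yes; no; does; contradiction)
open import Relation.Nullary.Decidable using (does-⇔; dec-false)
open import Relation.Unary using (Pred; Decidable)
open import Defs

-- Formal power series over a commutative ring

module SeriesRing {c ℓ} (R : CommutativeRing c ℓ) where
  open CommutativeRing R
  open PowerSeries rawRing
  open import Relation.Binary.Reasoning.Setoid setoid
  open import Algebra.Solver.Ring.NaturalCoefficients.Default commutativeSemiring
  open import Algebra.Properties.CommutativeSemigroup +-commutativeSemigroup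
    using (interchange)

  private
    regroup : ∀ a b x y z → (a * b) * x + (a * y + z) ≈ a * (b * x + y) + z
    regroup = solve 5 (λ a b x y z →
      (a :* b) :* x :+ (a :* y :+ z) :=
      a :* (b :* x :+ y) :+ z) refl

  infixl 6 _⊞_
  infixl 7 _⊙_

  -- The operations on series: sum, negative, and multiple by a scalar.
  _⊞_ : Series → Series → Series
  (f ⊞ g) n = f n + g n

  ⊟_ : Series → Series
  (⊟ f) n = - f n

  _⊙_ : Carrier → Series → Series
  (a ⊙ f) n = a * f n

  ⊛-cong : ∀ {f f′ g g′} → f ≋ f′ → g ≋ g′ → f ⊛ g ≋ f′ ⊛ g′
  ⊛-cong p q zero    = *-cong (p 0) (q 0)
  ⊛-cong p q (suc n) =
    +-cong (*-cong (p 0) (q (suc n))) (⊛-cong (p ∘ suc) q n)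

  ⊛-distribʳ : ∀ h f g → (f ⊞ g) ⊛ h ≋ (f ⊛ h) ⊞ (g ⊛ h)
  ⊛-distribʳ h f g zero    = distribʳ (h 0) (f 0) (g 0)
  ⊛-distribʳ h f g (suc n) =
    trans (+-cong (distribʳ (h (suc n)) (f 0) (g 0)) (⊛-distribʳ h (f ∘ suc) (g ∘ suc) n))
          (interchange _ _ _ _)

  ⊙-⊛ : ∀ a f g → (a ⊙ f) ⊛ g ≋ a ⊙ (f ⊛ g)
  ⊙-⊛ a f g zero    = *-assoc a (f 0) (g 0)
  ⊙-⊛ a f g (suc n) =
    trans (+-cong (*-assoc a (f 0) (g (suc n))) (⊙-⊛ a (f ∘ suc) g n))
          (sym (distribˡ a _ _))

  -- The constant term of the second factor split off:  f g = g₀ f + t f ((g - g₀) / t).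
  ⊛-suc′ : ∀ f g n → (f ⊛ g) (suc n) ≈ (f ⊛ (g ∘ suc)) n + f (suc n) * g 0
  ⊛-suc′ f g zero    = refl
  ⊛-suc′ f g (suc n) =
    trans (+-congˡ (⊛-suc′ (f ∘ suc) g n)) (sym (+-assoc _ _ _))

  ⊛-comm : ∀ f g → f ⊛ g ≋ g ⊛ f
  ⊛-comm f g zero    = *-comm (f 0) (g 0)
  ⊛-comm f g (suc n) = begin
    f 0 * g (suc n) + ((f ∘ suc) ⊛ g) n  ≈⟨ +-cong (*-comm _ _) (⊛-comm (f ∘ suc) g n) ⟩
    g (suc n) * f 0 + (g ⊛ (f ∘ suc)) n  ≈⟨ +-comm _ _ ⟩
    (g ⊛ (f ∘ suc)) n + g (suc n) * f 0  ≈⟨ ⊛-suc′ g f n ⟨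
    (g ⊛ f) (suc n)                      ∎

  ⊛-assoc : ∀ f g h → (f ⊛ g) ⊛ h ≋ f ⊛ (g ⊛ h)
  ⊛-assoc f g h zero    = *-assoc (f 0) (g 0) (h 0)
  ⊛-assoc f g h (suc n) = begin
    (f 0 * g 0) * h (suc n) + (((f 0 ⊙ (g ∘ suc)) ⊞ ((f ∘ suc) ⊛ g)) ⊛ h) n
      ≈⟨ +-congˡ (⊛-distribʳ h (f 0 ⊙ (g ∘ suc)) ((f ∘ suc) ⊛ g) n) ⟩
    (f 0 * g 0) * h (suc n) + (((f 0 ⊙ (g ∘ suc)) ⊛ h) n + (((f ∘ suc) ⊛ g) ⊛ h) n)
      ≈⟨ +-congˡ (+-cong (⊙-⊛ (f 0) (g ∘ suc) h n) (⊛-assoc (f ∘ suc) g h n)) ⟩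
    (f 0 * g 0) * h (suc n) + (f 0 * ((g ∘ suc) ⊛ h) n + ((f ∘ suc) ⊛ (g ⊛ h)) n)
      ≈⟨ regroup _ _ _ _ _ ⟩
    f 0 * (g 0 * h (suc n) + ((g ∘ suc) ⊛ h) n) + ((f ∘ suc) ⊛ (g ⊛ h)) n ∎

  ⊛-zeroˡ : ∀ {f} g → (∀ n → f n ≈ 0#) → ∀ n → (f ⊛ g) n ≈ 0#
  ⊛-zeroˡ g f≈0 zero    = trans (*-congʳ (f≈0 0)) (zeroˡ (g 0))
  ⊛-zeroˡ g f≈0 (suc n) =
    trans (+-cong (trans (*-congʳ (f≈0 0)) (zeroˡ _)) (⊛-zeroˡ g (f≈0 ∘ suc) n))
          (+-identityˡ 0#)

  ⊛-identityˡ : ∀ g → const 1# ⊛ g ≋ g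
  ⊛-identityˡ g zero    = *-identityˡ (g 0)
  ⊛-identityˡ g (suc n) =
    trans (+-cong (*-identityˡ _) (⊛-zeroˡ g (λ _ → refl) n)) (+-identityʳ _)

  ⊛-distribˡ : ∀ h f g → h ⊛ (f ⊞ g) ≋ (h ⊛ f) ⊞ (h ⊛ g)
  ⊛-distribˡ h f g n = begin
    (h ⊛ (f ⊞ g)) n          ≈⟨ ⊛-comm h (f ⊞ g) n ⟩
    ((f ⊞ g) ⊛ h) n          ≈⟨ ⊛-distribʳ h f g n ⟩
    (f ⊛ h) n + (g ⊛ h) n    ≈⟨ +-cong (⊛-comm f h n) (⊛-comm g h n) ⟩
    (h ⊛ f) n + (h ⊛ g) n    ∎

  seriesRing : CommutativeRing c ℓ
  seriesRing = record
    { Carrier = Series ; _≈_ = _≋_ ; _+_ = _⊞_ ; _*_ = _⊛_ ; -_ = ⊟_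
    ; 0# = λ _ → 0# ; 1# = const 1#
    ; isCommutativeRing = record
      { isRing = record
        { +-isAbelianGroup = record
          { isGroup = record
            { isMonoid = record
              { isSemigroup = record
                { isMagma = record
                  { isEquivalence = record
                    { refl = λ _ → refl
                    ; sym = λ p n → sym (p n)
                    ; trans = λ p q n → trans (p n) (q n) }
                  ; ∙-cong = λ p q n → +-cong (p n) (q n) }
                ; assoc = λ f g h n → +-assoc _ _ _ }
              ; identity = (λ f n → +-identityˡ _) , (λ f n → +-identityʳ _) }
            ; inverse = (λ f n → -‿inverseˡ _) , (λ f n → -‿inverseʳ _)
            ; ⁻¹-cong = λ p n → -‿cong (p n) }
          ; comm = λ f g n → +-comm _ _ }
        ; *-cong = ⊛-cong
        ; *-assoc = ⊛-assoc
        ; *-identity = ⊛-identityˡ , λ f n → trans (⊛-comm f (const 1#) n) (⊛-identityˡ f n)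
        ; distrib = ⊛-distribˡ , ⊛-distribʳ }
      ; *-comm = ⊛-comm } }

-- The polynomial ring

-- The coefficient map into power series over ℚ is injective, because equality
-- of polynomials is equality of coefficients; so the ring laws are inherited.
polyRing : CommutativeRing 0ℓ 0ℓ
polyRing = record
  { Carrier = ℚ[x] ; _≈_ = Poly._≈_ ; _+_ = Poly._+_ ; _*_ = Poly._*_ ; -_ = Poly.-_
  ; 0# = [] ; 1# = 1ℚ ∷ []
  ; isCommutativeRing = RingMonomorphism.isCommutativeRing coeff-mono S.isCommutativeRing }
  where
  open SeriesRing ℚₚ.+-*-commutativeRing
  open PowerSeries ℚ.+-*-rawRing
  module S = CommutativeRing seriesRing

  coeff-⊛ : ∀ p q → Poly.coeff (p Poly.* q) ≋ Poly.coeff p ⊛ Poly.coeff q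
  coeff-⊛ []      q i       = ≡.sym (⊛-zeroˡ (Poly.coeff q) (λ _ → ≡.refl) i)
  coeff-⊛ (a ∷ p) q zero    = ≡.trans (Poly.coeff-* a p q 0) (ℚₚ.+-identityʳ _)
  coeff-⊛ (a ∷ p) q (suc i) = ≡.trans (Poly.coeff-* a p q (suc i))
    (≡.cong (a ℚ.* Poly.coeff q (suc i) ℚ.+_) (coeff-⊛ p q i))

  coeff-neg : ∀ p i → Poly.coeff (Poly.- p) i ≡ ℚ.- Poly.coeff p i
  coeff-neg []      i       = ≡.refl
  coeff-neg (a ∷ p) zero    = ≡.refl
  coeff-neg (a ∷ p) (suc i) = coeff-neg p i

  coeff-mono : IsRingMonomorphism
    (record { Carrier = ℚ[x] ; _≈_ = Poly._≈_ ; _+_ = Poly._+_ ; _*_ = Poly._*_ ; -_ = Poly.-_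
            ; 0# = [] ; 1# = 1ℚ ∷ [] })
    S.rawRing Poly.coeff
  coeff-mono = record
    { isRingHomomorphism = record
      { isSemiringHomomorphism = record
        { isNearSemiringHomomorphism = record
          { +-isMonoidHomomorphism = record
            { isMagmaHomomorphism = record
              { isRelHomomorphism = record { cong = λ p → p }
              ; homo = Poly.coeff-+ }
            ; ε-homo = λ _ → ≡.refl }
          ; *-homo = coeff-⊛ }
        ; 1#-homo = λ { zero → ≡.refl ; (suc _) → ≡.refl } }
      ; -‿homo = coeff-neg }
    ; injective = λ p → p }

-- The ring of rational functions

-- Fractions a / b, c / d, … over a commutative ring, compared by cross
-- multiplication:  a / b = c / d  means  a d ≈ c b.  Each lemma is a ring law
-- for fractions, multiplied out; no fraction occurs as an object.

module Fractions {c ℓ} (R : CommutativeRing c ℓ) where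
  open CommutativeRing R
  open import Algebra.Properties.Ring ring
    using (-‿distribˡ-*; -‿distribʳ-*; x∙y⁻¹≈ε⇒x≈y)
  open import Algebra.Properties.CommutativeSemigroup *-commutativeSemigroup
    using (interchange; x∙yz≈yx∙z; xy∙z≈xz∙y)
  open import Algebra.Solver.Ring.NaturalCoefficients.Default commutativeSemiring
  open import Relation.Binary.Reasoning.Setoid setoid

  frac-expand : ∀ a b c d x y →
    (a * d + c * b) * (x * y) ≈ (a * x) * (d * y) + (c * y) * (b * x)
  frac-expand = solve 6 (λ a b c d x y →
    (a :* d :+ c :* b) :* (x :* y) :=
    (a :* x) :* (d :* y) :+ (c :* y) :* (b :* x)) refl

  frac-+-assoc : ∀ a b c d e f →
    ((a * d + c * b) * f + e * (b * d)) * (b * (d * f)) ≈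
    (a * (d * f) + (c * f + e * d) * b) * ((b * d) * f)
  frac-+-assoc = solve 6 (λ a b c d e f →
    ((a :* d :+ c :* b) :* f :+ e :* (b :* d)) :* (b :* (d :* f)) :=
    (a :* (d :* f) :+ (c :* f :+ e :* d) :* b) :* ((b :* d) :* f)) refl

  frac-+-comm : ∀ a b c d →
    (a * d + c * b) * (d * b) ≈ (c * b + a * d) * (b * d)
  frac-+-comm = solve 4 (λ a b c d →
    (a :* d :+ c :* b) :* (d :* b) :=
    (c :* b :+ a :* d) :* (b :* d)) refl

  frac-*-assoc : ∀ a b c d e f →
    ((a * c) * e) * (b * (d * f)) ≈ (a * (c * e)) * ((b * d) * f)
  frac-*-assoc = solve 6 (λ a b c d e f →
    ((a :* c) :* e) :* (b :* (d :* f)) :=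
    (a :* (c :* e)) :* ((b :* d) :* f)) refl

  frac-*-comm : ∀ a b c d → (a * c) * (d * b) ≈ (c * a) * (b * d)
  frac-*-comm = solve 4 (λ a b c d →
    (a :* c) :* (d :* b) :=
    (c :* a) :* (b :* d)) refl

  frac-distribˡ : ∀ a b c d e f →
    (a * (c * f + e * d)) * ((b * d) * (b * f)) ≈
    ((a * c) * (b * f) + (a * e) * (b * d)) * (b * (d * f))
  frac-distribˡ = solve 6 (λ a b c d e f →
    (a :* (c :* f :+ e :* d)) :* ((b :* d) :* (b :* f)) :=
    ((a :* c) :* (b :* f) :+ (a :* e) :* (b :* d)) :* (b :* (d :* f))) refl

  frac-distribʳ : ∀ a b c d e f →
    ((c * f + e * d) * a) * ((d * b) * (f * b)) ≈
    ((c * a) * (f * b) + (e * a) * (d * b)) * ((d * f) * b)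
  frac-distribʳ = solve 6 (λ a b c d e f →
    ((c :* f :+ e :* d) :* a) :* ((d :* b) :* (f :* b)) :=
    ((c :* a) :* (f :* b) :+ (e :* a) :* (d :* b)) :* ((d :* f) :* b)) refl

  -- Transitivity needs the middle denominator to be cancellable.
  frac-trans : ∀ a b c d e f → (∀ z → d * z ≈ 0# → z ≈ 0#) →
               a * d ≈ c * b → c * f ≈ e * d → a * f ≈ e * b
  frac-trans a b c d e f d-regular ad≈cb cf≈ed =
    x∙y⁻¹≈ε⇒x≈y (a * f) (e * b) (d-regular _ (begin
      d * (a * f + - (e * b))        ≈⟨ distribˡ d _ _ ⟩
      d * (a * f) + d * - (e * b)    ≈⟨ +-cong d[af]≈d[eb] (sym (-‿distribʳ-* d (e * b))) ⟩
      d * (e * b) + - (d * (e * b))  ≈⟨ -‿inverseʳ _ ⟩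
      0#                             ∎))
    where
    d[af]≈d[eb] : d * (a * f) ≈ d * (e * b)
    d[af]≈d[eb] = begin
      d * (a * f)  ≈⟨ x∙yz≈yx∙z d a f ⟩
      (a * d) * f  ≈⟨ *-congʳ ad≈cb ⟩
      (c * b) * f  ≈⟨ xy∙z≈xz∙y c b f ⟩
      (c * f) * b  ≈⟨ *-congʳ cf≈ed ⟩
      (e * d) * b  ≈⟨ x∙yz≈yx∙z d e b ⟨
      d * (e * b)  ∎

  frac-+-cong : ∀ a b a′ b′ c d c′ d′ → a * b′ ≈ a′ * b → c * d′ ≈ c′ * d →
    (a * d + c * b) * (b′ * d′) ≈ (a′ * d′ + c′ * b′) * (b * d)
  frac-+-cong a b a′ b′ c d c′ d′ p q = begin
    (a * d + c * b) * (b′ * d′)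
      ≈⟨ frac-expand a b c d b′ d′ ⟩
    (a * b′) * (d * d′) + (c * d′) * (b * b′)
      ≈⟨ +-cong (*-cong p (*-comm d d′)) (*-cong q (*-comm b b′)) ⟩
    (a′ * b) * (d′ * d) + (c′ * d) * (b′ * b)
      ≈⟨ frac-expand a′ b′ c′ d′ b d ⟨
    (a′ * d′ + c′ * b′) * (b * d) ∎

  frac-*-cong : ∀ a b a′ b′ c d c′ d′ → a * b′ ≈ a′ * b → c * d′ ≈ c′ * d →
    (a * c) * (b′ * d′) ≈ (a′ * c′) * (b * d)
  frac-*-cong a b a′ b′ c d c′ d′ p q = begin
    (a * c) * (b′ * d′)  ≈⟨ interchange a c b′ d′ ⟩
    (a * b′) * (c * d′)  ≈⟨ *-cong p q ⟩
    (a′ * b) * (c′ * d)  ≈⟨ interchange a′ b c′ d ⟩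
    (a′ * c′) * (b * d)  ∎

  frac-‿cong : ∀ a b c d → a * d ≈ c * b → (- a) * d ≈ (- c) * b
  frac-‿cong a b c d p = begin
    (- a) * d    ≈⟨ -‿distribˡ-* a d ⟨
    - (a * d)    ≈⟨ -‿cong p ⟩
    - (c * b)    ≈⟨ -‿distribˡ-* c b ⟩
    (- c) * b    ∎

  frac-+-identityˡ : ∀ a b → (0# * b + a * 1#) * b ≈ a * (1# * b)
  frac-+-identityˡ a b =
    *-cong (trans (+-cong (zeroˡ b) (*-identityʳ a)) (+-identityˡ a))
           (sym (*-identityˡ b))

  frac-+-identityʳ : ∀ a b → (a * 1# + 0# * b) * b ≈ a * (b * 1#)
  frac-+-identityʳ a b =
    *-cong (trans (+-cong (*-identityʳ a) (zeroˡ b)) (+-identityʳ a))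
           (sym (*-identityʳ b))

  frac-*-identityˡ : ∀ a b → (1# * a) * b ≈ a * (1# * b)
  frac-*-identityˡ a b = *-cong (*-identityˡ a) (sym (*-identityˡ b))

  frac-*-identityʳ : ∀ a b → (a * 1#) * b ≈ a * (b * 1#)
  frac-*-identityʳ a b = *-cong (*-identityʳ a) (sym (*-identityʳ b))

  frac-‿inverseˡ : ∀ a b → ((- a) * b + a * b) * 1# ≈ 0# * (b * b)
  frac-‿inverseˡ a b = begin
    ((- a) * b + a * b) * 1#  ≈⟨ *-identityʳ _ ⟩
    (- a) * b + a * b         ≈⟨ distribʳ b (- a) a ⟨
    (- a + a) * b             ≈⟨ *-congʳ (-‿inverseˡ a) ⟩
    0# * b                    ≈⟨ zeroˡ b ⟩
    0#                        ≈⟨ zeroˡ (b * b) ⟨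
    0# * (b * b)              ∎

  frac-‿inverseʳ : ∀ a b → (a * b + (- a) * b) * 1# ≈ 0# * (b * b)
  frac-‿inverseʳ a b =
    trans (*-congʳ (+-comm (a * b) ((- a) * b))) (frac-‿inverseˡ a b)

  -- a / 1 + b / 1 = (a + b) / 1
  frac-/1-+ : ∀ a b → (a * 1# + b * 1#) * 1# ≈ (a + b) * (1# * 1#)
  frac-/1-+ a b =
    *-cong (+-cong (*-identityʳ a) (*-identityʳ b)) (sym (*-identityˡ 1#))

  -- (a / 1) (b / 1) = a b / 1, with a standing for the product a b.
  frac-/1-* : ∀ a → a * 1# ≈ a * (1# * 1#)
  frac-/1-* a = *-congˡ (sym (*-identityˡ 1#))

ratRing : CommutativeRing 0ℓ 0ℓ
ratRing = record
  { Carrier = ℚ⟨x⟩ ; _≈_ = _≈_ ; _+_ = _+_ ; _*_ = _*_ ; -_ = -_ ; 0# = 0# ; 1# = 1#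
  ; isCommutativeRing = record
    { isRing = record
      { +-isAbelianGroup = record
        { isGroup = record
          { isMonoid = record
            { isSemigroup = record
              { isMagma = record
                { isEquivalence = record
                  { refl = λ { {r} i → ≡.refl }
                  ; sym = λ { p i → ≡.sym (p i) }
                  ; trans = λ { {frac a b _} {frac c d d≉0} {frac e f _} →
                      frac-trans a b c d e f (λ z → Poly.*≈0⇒≈0ʳ d z d≉0) } }
                ; ∙-cong = λ { {frac a b _} {frac a′ b′ _} {frac c d _} {frac c′ d′ _} →
                    frac-+-cong a b a′ b′ c d c′ d′ } }
              ; assoc = λ { (frac a b _) (frac c d _) (frac e f _) →
                  frac-+-assoc a b c d e f } }
            ; identity = (λ { (frac a b _) → frac-+-identityˡ a b })
                       , (λ { (frac a b _) → frac-+-identityʳ a b }) }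
          ; inverse = (λ { (frac a b _) → frac-‿inverseˡ a b })
                    , (λ { (frac a b _) → frac-‿inverseʳ a b })
          ; ⁻¹-cong = λ { {frac a b _} {frac c d _} → frac-‿cong a b c d } }
        ; comm = λ { (frac a b _) (frac c d _) → frac-+-comm a b c d } }
      ; *-cong = λ { {frac a b _} {frac a′ b′ _} {frac c d _} {frac c′ d′ _} →
          frac-*-cong a b a′ b′ c d c′ d′ }
      ; *-assoc = λ { (frac a b _) (frac c d _) (frac e f _) → frac-*-assoc a b c d e f }
      ; *-identity = (λ { (frac a b _) → frac-*-identityˡ a b })
                   , (λ { (frac a b _) → frac-*-identityʳ a b })
      ; distrib = (λ { (frac a b _) (frac c d _) (frac e f _) → frac-distribˡ a b c d e f })
                , (λ { (frac a b _) (frac c d _) (frac e f _) → frac-distribʳ a b c d e f }) }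
    ; *-comm = λ { (frac a b _) (frac c d _) → frac-*-comm a b c d } } }
  where
  open Rat
  open Fractions polyRing

module Combinatorics where
  open import Data.Nat.Base using (_+_; _*_; _∸_)
  open ℕₚ hiding (_≟_)
  open ≡

  -- Ascending lists and subsets

  -- A finite set of numbers is encoded as its ascending list, and a subset of
  -- given size r as an ascending vector of length r.
  Ascending : List ℕ → Set
  Ascending = AllPairs _<_

  ascending⇒unique : ∀ {S} → Ascending S → Unique S
  ascending⇒unique = AllPairs.map <⇒≢

  increasing⇒ascending : ∀ {n} {C : Vec ℕ n} → Increasing C → Ascending (toList C)
  increasing⇒ascending []                                    = []
  increasing⇒ascending [-]                                   = [] ∷ []
  increasing⇒ascending {C = _ ∷ _ ∷ _} (a<b ∷ C↑) =
    VecAllₚ.toList⁺ (Linkedₚ.Linked⇒All <-trans a<b C↑) ∷ increasing⇒ascending C↑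

  ascending⇒increasing : ∀ {n} {C : Vec ℕ n} → Ascending (toList C) → Increasing C
  ascending⇒increasing {C = []}        []                = []
  ascending⇒increasing {C = _ ∷ []}    _                 = [-]
  ascending⇒increasing {C = _ ∷ _ ∷ _} ((a<b ∷ _) ∷ C↑) = a<b ∷ ascending⇒increasing C↑

  -- All the ways of splitting a list S into a sublist U of length r and the
  -- complementary sublist T; for S ascending, these are the subsets U of S of
  -- size r, each with its complement.
  splits : ∀ r → List ℕ → List (Vec ℕ r × List ℕ)
  splits zero    S       = ([] , S) ∷ []
  splits (suc r) []      = []
  splits (suc r) (a ∷ S) =
    map (λ (U , T) → a ∷ U , T) (splits r S) ++
    map (λ (U , T) → U , a ∷ T) (splits (suc r) S)

  splits-↭ : ∀ r S → All (λ (U , T) → toList U ++ T ↭ S) (splits r S)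
  splits-↭ zero    S       = ↭-refl ∷ []
  splits-↭ (suc r) []      = []
  splits-↭ (suc r) (a ∷ S) = Allₚ.++⁺
    (Allₚ.map⁺ (All.map (Perm.prep a) (splits-↭ r S)))
    (Allₚ.map⁺ (All.map (λ {(U , T)} p → ↭-trans (shift a (toList U) T) (Perm.prep a p))
      (splits-↭ (suc r) S)))

  splits-All : ∀ {ℓ} {P : Pred ℕ ℓ} r {S} → All P S →
               All (λ (U , T) → All P (toList U) × All P T) (splits r S)
  splits-All r {S} pS =
    All.map (λ {(U , T)} p → Allₚ.++⁻ (toList U) (All-resp-↭ (↭-sym p) pS)) (splits-↭ r S)

  splits-ascending : ∀ r {S} → Ascending S →
                     All (λ (U , T) → Ascending (toList U) × Ascending T) (splits r S)
  splits-ascending zero    S↑          = ([] , S↑) ∷ []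
  splits-ascending (suc r) []          = []
  splits-ascending (suc r) (a<S ∷ S↑) = Allₚ.++⁺
    (Allₚ.map⁺ (All.zipWith (λ ((a<U , _) , (U↑ , T↑)) → a<U ∷ U↑ , T↑)
      (splits-All r a<S , splits-ascending r S↑)))
    (Allₚ.map⁺ (All.zipWith (λ ((_ , a<T) , (U↑ , T↑)) → U↑ , a<T ∷ T↑)
      (splits-All (suc r) a<S , splits-ascending (suc r) S↑)))

  splits-distinct : ∀ r {S} → Ascending S →
                    AllPairs (λ p q → proj₁ p ≢ proj₁ q) (splits r S)
  splits-distinct zero    S↑ = [] ∷ []
  splits-distinct (suc r) [] = []
  splits-distinct (suc r) {a ∷ S} (a<S ∷ S↑) = AllPairsₚ.++⁺
    (AllPairsₚ.map⁺ (AllPairs.map (λ U≢U′ → U≢U′ ∘ Vecₚ.∷-injectiveʳ) (splits-distinct r S↑)))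
    (AllPairsₚ.map⁺ (splits-distinct (suc r) S↑))
    (Allₚ.map⁺ (All.universal (λ _ → Allₚ.map⁺ (All.map a∉ (splits-All (suc r) a<S))) _))
    where
    a∉ : ∀ {U : Vec ℕ r} {q : Vec ℕ (suc r) × List ℕ} →
         All (a <_) (toList (proj₁ q)) × All (a <_) (proj₂ q) → a ∷ U ≢ proj₁ q
    a∉ {q = _ ∷ _ , _} (a<a ∷ _ , _) refl = <-irrefl refl a<a

  -- Every r-subset of S occurs; its complement is determined by splits-↭.
  splits-complete : ∀ {r S} (C : Vec ℕ r) → Ascending (toList C) → Ascending S →
                    All (_∈ S) (toList C) → ∃ λ T → (C , T) ∈ splits r S
  splits-complete [] _ _ _ = -, here refl
  splits-complete {suc r} {a ∷ S} (c ∷ C) (c<C ∷ C↑) (a<S ∷ S↑) (here refl ∷ C⊆S) =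
    let T , C∈ = splits-complete C C↑ S↑ (All.zipWith drop-head (c<C , C⊆S))
    in T , ∈-++⁺ˡ (∈-map⁺ _ C∈)
    where
    drop-head : ∀ {v} → (a < v) × (v ∈ a ∷ S) → v ∈ S
    drop-head (a<a , here refl) = contradiction a<a (<-irrefl refl)
    drop-head (_   , there v∈S) = v∈S
  splits-complete {suc r} {a ∷ S} (c ∷ C) (c<C ∷ C↑) (a<S ∷ S↑) (there c∈S ∷ C⊆S) =
    let T , C∈ = splits-complete (c ∷ C) (c<C ∷ C↑) S↑
                   (c∈S ∷ All.zipWith drop-head (c<C , C⊆S))
    in a ∷ T , ∈-++⁺ʳ _ (∈-map⁺ _ C∈)
    where
    drop-head : ∀ {v} → (c < v) × (v ∈ a ∷ S) → v ∈ S
    drop-head (c<a , here refl) = contradiction c<a (<-asym (All.lookup a<S c∈S))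
    drop-head (_   , there v∈S) = v∈S

  length-splits : ∀ r S → length (splits r S) ≡ length S choose r
  length-splits zero    S       = refl
  length-splits (suc r) []      = refl
  length-splits (suc r) (a ∷ S) = begin
    length (map _ (splits r S) ++ map _ (splits (suc r) S))
      ≡⟨ Listₚ.length-++ (map _ (splits r S)) ⟩
    length (map _ (splits r S)) + length (map _ (splits (suc r) S))
      ≡⟨ cong₂ _+_ (Listₚ.length-map _ (splits r S)) (Listₚ.length-map _ (splits (suc r) S)) ⟩
    length (splits r S) + length (splits (suc r) S)
      ≡⟨ cong₂ _+_ (length-splits r S) (length-splits (suc r) S) ⟩
    length S choose r + length S choose suc r
      ≡⟨ nCk+nC[k+1]≡[n+1]C[k+1] (length S) r ⟩
    suc (length S) choose suc r ∎
    where open ≡-Reasoning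

  -- The binomial coefficient, with the factorials cleared.
  splits-! : ∀ r m S → length S ≡ r + m →
             length (splits r S) * (r ! * m !) ≡ length S !
  splits-! r m S |S|≡r+m = begin
    length (splits r S) * (r ! * m !)
      ≡⟨ cong₂ (λ n l → n * (r ! * l !)) (length-splits r S) (sym |S|∸r≡m) ⟩
    (length S choose r) * (r ! * (length S ∸ r) !)
      ≡⟨ cong (_* (r ! * (length S ∸ r) !)) (nCk≡n!/k![n-k]! r≤|S|) ⟩
    (length S ! ℕ./ (r ! * (length S ∸ r) !)) * (r ! * (length S ∸ r) !)
      ≡⟨ m/n*n≡m (k![n∸k]!∣n! r≤|S|) ⟩
    length S ! ∎
    where
    open ≡-Reasoning
    instance _ = m*n≢0 (r !) ((length S ∸ r) !) ⦃ r !≢0 ⦄ ⦃ (length S ∸ r) !≢0 ⦄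
    r≤|S| : r ≤ length S
    r≤|S| = subst (r ≤_) (sym |S|≡r+m) (m≤m+n r m)
    |S|∸r≡m : length S ∸ r ≡ m
    |S|∸r≡m = trans (cong (_∸ r) |S|≡r+m) (m+n∸m≡n r m)

  -- Fillings by a given set

  -- The arrays whose n columns are pairwise disjoint k-subsets of S, chosen one
  -- after the other.  They need not exhaust S, but do if S has k n elements.
  fillings : ∀ n k → List ℕ → List (Array n k)
  fillings zero    k S = [] ∷ []
  fillings (suc n) k S =
    concatMap (λ (C , T) → map (C ∷_) (fillings n k T)) (splits k S)

  entries-∷ : ∀ {n k} (C : Vec ℕ k) (F : Array n k) → entries (C ∷ F) ≡ toList C ++ entries F
  entries-∷ C F = Vecₚ.toList-++ C (Vec.concat F)

  -- The property that characterises membership in fillings n k S.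
  IsFillingOf : ∀ {n k} → List ℕ → Array n k → Set
  IsFillingOf S F = All (_∈ S) (entries F) × Unique (entries F) × VecAll.All Increasing F

  ++-unique⁻ : ∀ {A : Set} (xs : List A) {ys} → Unique (xs ++ ys) → Disjoint xs ys
  ++-unique⁻ (x ∷ xs) (x∉ ∷ u) (here refl , v∈ys) = All.lookup x∉ (∈-++⁺ʳ xs v∈ys) refl
  ++-unique⁻ (x ∷ xs) (x∉ ∷ u) (there v∈xs , v∈ys) = ++-unique⁻ xs u (v∈xs , v∈ys)

  unique-++ʳ⁻ : ∀ {A : Set} (xs : List A) {ys} → Unique (xs ++ ys) → Unique ys
  unique-++ʳ⁻ []       u       = u
  unique-++ʳ⁻ (x ∷ xs) (_ ∷ u) = unique-++ʳ⁻ xs u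

  splits-disjoint : ∀ {r S} {C : Vec ℕ r} {T} → Ascending S → (C , T) ∈ splits r S →
                    Disjoint (toList C) T
  splits-disjoint {r} {S} {C} {T} S↑ C∈ = ++-unique⁻ (toList C) unique
    where
    unique : Unique (toList C ++ T)
    unique = Unique-resp-↭ (setoid ℕ) (↭⇒↭ₛ (↭-sym (All.lookup (splits-↭ r S) C∈)))
               (ascending⇒unique S↑)

  fillings-sound : ∀ {n k S} {F : Array n k} → Ascending S → F ∈ fillings n k S → IsFillingOf S F
  fillings-sound {zero}          {F = []} S↑ _  = [] , [] , []
  fillings-sound {suc n} {k} {S} S↑ F∈
    with find (∈-concatMap⁻ (λ (C , T) → map (C ∷_) (fillings n k T)) {xs = splits k S} F∈)
  ... | (C , T) , CT∈ , F∈′ with ∈-map⁻ (C ∷_) F∈′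
  ... | F , F∈T , refl =
    let C↑ , T↑    = All.lookup (splits-ascending k S↑) CT∈
        C⊆S , T⊆S  = All.lookup (splits-All k (All.tabulate (λ v∈S → v∈S))) CT∈
        F⊆T , F! , F↑ = fillings-sound T↑ F∈T
    in subst (All (_∈ S)) (sym (entries-∷ C F))
         (Allₚ.++⁺ C⊆S (All.map (All.lookup T⊆S) F⊆T))
     , subst Unique (sym (entries-∷ C F))
         (Uniqueₚ.++⁺ (ascending⇒unique C↑) F!
           (λ (v∈C , v∈F) → splits-disjoint S↑ CT∈ (v∈C , All.lookup F⊆T v∈F)))
     , ascending⇒increasing C↑ ∷ F↑

  fillings-complete : ∀ {n k S} {F : Array n k} → Ascending S → IsFillingOf S F → F ∈ fillings n k S
  fillings-complete {zero}  {F = []}    S↑ _ = here refl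
  fillings-complete {suc n} {k} {S} {F = C ∷ F} S↑ (F⊆S , F! , C↑ ∷ F↑) =
    let C⊆S , F⊆S′ = Allₚ.++⁻ (toList C) (subst (All (_∈ S)) (entries-∷ C F) F⊆S)
        CF!        = subst Unique (entries-∷ C F) F!
        T , CT∈    = splits-complete C (increasing⇒ascending C↑) S↑ C⊆S
        T↑         = proj₂ (All.lookup (splits-ascending k S↑) CT∈)
        S↭         = ↭-sym (All.lookup (splits-↭ k S) CT∈)
        F⊆T        = All.tabulate λ v∈F →
                       case ∈-++⁻ (toList C) (∈-resp-↭ S↭ (All.lookup F⊆S′ v∈F)) of λ
                       { (inj₁ v∈C) → ⊥-elim (++-unique⁻ (toList C) CF! (v∈C , v∈F))
                       ; (inj₂ v∈T) → v∈T }
    in ∈-concat⁺′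
         (∈-map⁺ (C ∷_) (fillings-complete T↑ (F⊆T , unique-++ʳ⁻ (toList C) CF! , F↑)))
         (∈-map⁺ _ CT∈)

  fillings-unique : ∀ n k {S} → Ascending S → Unique (fillings n k S)
  fillings-unique zero    k S↑ = [] ∷ []
  fillings-unique (suc n) k S↑ = Uniqueₚ.concat⁺
    (Allₚ.map⁺ (All.map (λ (_ , T↑) → Uniqueₚ.map⁺ Vecₚ.∷-injectiveʳ (fillings-unique n k T↑))
      (splits-ascending k S↑)))
    (AllPairsₚ.map⁺ (AllPairs.map (λ C≢C′ {_} (F∈ , F∈′) →
        let _ , _ , p = ∈-map⁻ _ F∈ ; _ , _ , q = ∈-map⁻ _ F∈′
        in C≢C′ (Vecₚ.∷-injectiveˡ (trans (sym p) q)))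
      (splits-distinct k S↑)))

  vectorsOver-complete : ∀ {A : Set} {as : List A} {n} {v : Vec A n} →
                         VecAll.All (_∈ as) v → v ∈ vectorsOver as n
  vectorsOver-complete []         = here refl
  vectorsOver-complete (a∈ ∷ v∈) = ∈-cartesianProductWith⁺ _∷_ a∈ (vectorsOver-complete v∈)

  vectorsOver-unique : ∀ {A : Set} {as : List A} → Unique as → ∀ n → Unique (vectorsOver as n)
  vectorsOver-unique as! zero    = [] ∷ []
  vectorsOver-unique as! (suc n) =
    Uniqueₚ.cartesianProductWith⁺ _∷_ Vecₚ.∷-injective as! (vectorsOver-unique as! n)

  -- The list 1, …, N.
  range : ℕ → List ℕ
  range N = applyUpTo suc N

  range-ascending : ∀ N → Ascending (range N)
  range-ascending N = AllPairsₚ.applyUpTo⁺₁ suc N (λ i<j _ → s≤s i<j)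

  ∈-range⁺ : ∀ {v N} → 1 ≤ v × v ≤ N → v ∈ range N
  ∈-range⁺ {suc v} (_ , v<N) = ∈-applyUpTo⁺ suc v<N

  ∈-range⁻ : ∀ {v N} → v ∈ range N → 1 ≤ v × v ≤ N
  ∈-range⁻ v∈ with ∈-applyUpTo⁻ suc v∈
  ... | i , i<N , refl = s≤s z≤n , i<N

  -- Both lists are free of repetitions and have the same members: both ask for
  -- increasing columns and distinct entries from 1, …, k n, so no counting of cells
  -- is involved.
  𝓕↭fillings : ∀ n k → 𝓕 n k ↭ fillings n k (range (k * n))
  𝓕↭fillings n k = ∼bag⇒↭ (unique∧set⇒bag 𝓕-unique
    (fillings-unique n k (range-ascending (k * n))) (mk⇔ to from))
    where
    𝓕-unique : Unique (𝓕 n k)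
    𝓕-unique = Uniqueₚ.filter⁺ isFilling? (vectorsOver-unique
      (vectorsOver-unique (ascending⇒unique (range-ascending (k * n))) k) n)
    to : ∀ {F} → F ∈ 𝓕 n k → F ∈ fillings n k (range (k * n))
    to F∈ =
      let bounds , F! , F↑ = proj₂ (∈-filter⁻ isFilling? {xs = vectorsOver _ n} F∈)
      in fillings-complete (range-ascending (k * n)) (All.map ∈-range⁺ bounds , F! , F↑)
    from : ∀ {F} → F ∈ fillings n k (range (k * n)) → F ∈ 𝓕 n k
    from {F} F∈ =
      let F⊆ , F! , F↑ = fillings-sound (range-ascending (k * n)) F∈
      in ∈-filter⁺ isFilling?
           (vectorsOver-complete
             (VecAll.map vectorsOver-complete (VecAllₚ.concat⁻ F (VecAllₚ.toList⁻ F⊆))))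
           (All.map ∈-range⁻ F⊆ , F! , F↑)

  -- Matches

  -- Every entry of C is smaller than every entry of C′.
  Before : ∀ {r k} → Vec ℕ r → Vec ℕ k → Set
  Before C C′ = All (λ c → All (c <_) (toList C′)) (toList C)

  before? : ∀ {r k} (C : Vec ℕ r) (C′ : Vec ℕ k) → Dec (Before C C′)
  before? C C′ = All.all? (λ c → All.all? (c <?_) (toList C′)) (toList C)

  rank-accept : ∀ {a v} L → a ≤ v → rank (a ∷ L) v ≡ suc (rank L v)
  rank-accept {v = v} L a≤v = cong length (Listₚ.filter-accept (_≤? v) {xs = L} a≤v)

  rank-reject : ∀ {a v} L → ¬ a ≤ v → rank (a ∷ L) v ≡ rank L v
  rank-reject {v = v} L a≰v = cong length (Listₚ.filter-reject (_≤? v) {xs = L} a≰v)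

  rank-mono : ∀ L {u v} → u ≤ v → rank L u ≤ rank L v
  rank-mono []      u≤v = z≤n
  rank-mono (a ∷ L) {u} {v} u≤v = cases (a ≤? u) (a ≤? v)
    where
    cases : Dec (a ≤ u) → Dec (a ≤ v) → rank (a ∷ L) u ≤ rank (a ∷ L) v
    cases (yes a≤u) _         = subst₂ _≤_ (sym (rank-accept L a≤u))
      (sym (rank-accept L (≤-trans a≤u u≤v))) (s≤s (rank-mono L u≤v))
    cases (no a≰u)  (yes a≤v) = subst₂ _≤_ (sym (rank-reject L a≰u))
      (sym (rank-accept L a≤v)) (m≤n⇒m≤1+n (rank-mono L u≤v))
    cases (no a≰u)  (no a≰v)  = subst₂ _≤_ (sym (rank-reject L a≰u))
      (sym (rank-reject L a≰v)) (rank-mono L u≤v)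

  -- The list b + 1, …, b + n.
  rangeFrom : ℕ → ℕ → List ℕ
  rangeFrom b zero    = []
  rangeFrom b (suc n) = suc b ∷ rangeFrom (suc b) n

  -- The ranks in an ascending list are 1, 2, …; the shift by b makes the
  -- statement inductive.
  ascending-rank : ∀ b {L} → Ascending L → map (λ v → b + rank L v) L ≡ rangeFrom b (length L)
  ascending-rank b []                     = refl
  ascending-rank b {a ∷ L} (a<L ∷ L↑) = cong₂ _∷_ head-rank
    (trans (Listₚ.map-cong-local (All.map tail-rank a<L)) (ascending-rank (suc b) L↑))
    where
    open ≡-Reasoning
    head-rank : b + rank (a ∷ L) a ≡ suc b
    head-rank = begin
      b + rank (a ∷ L) a
        ≡⟨ cong (b +_) (rank-accept L ≤-refl) ⟩
      b + suc (rank L a)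
        ≡⟨ cong (λ l → b + suc (length l)) (Listₚ.filter-none (_≤? a) (All.map <⇒≱ a<L)) ⟩
      b + 1
        ≡⟨ +-comm b 1 ⟩
      suc b ∎
    tail-rank : ∀ {v} → a < v → b + rank (a ∷ L) v ≡ suc b + rank L v
    tail-rank {v} a<v = begin
      b + rank (a ∷ L) v
        ≡⟨ cong (b +_) (rank-accept L (<⇒≤ a<v)) ⟩
      b + suc (rank L v)
        ≡⟨ +-suc b (rank L v) ⟩
      suc b + rank L v ∎

  -- An ascending list of N numbers between b + 1 and b + N contains them all.
  ascending-range : ∀ b {L} → Ascending L → All (b <_) L → All (_≤ b + length L) L →
                    L ≡ rangeFrom b (length L)
  ascending-range b []          _              _ = refl
  ascending-range b {a ∷ L} (a<L ∷ L↑) (b<a ∷ _) (a≤ ∷ L≤) =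
    cong₂ _∷_ (≤-antisym (a≤1+b L a<L a≤ L≡) b<a) L≡
    where
    L≡ : L ≡ rangeFrom (suc b) (length L)
    L≡ = ascending-range (suc b) L↑ (All.map (≤-<-trans b<a) a<L)
           (subst (λ m → All (_≤ m) L) (+-suc b (length L)) L≤)
    a≤1+b : ∀ L → All (a <_) L → a ≤ b + suc (length L) → L ≡ rangeFrom (suc b) (length L) →
            a ≤ suc b
    a≤1+b []      _         a≤ _  = subst (a ≤_) (+-comm b 1) a≤
    a≤1+b (_ ∷ _) (a<c ∷ _) _  eq = ≤-pred (subst (a <_) (Listₚ.∷-injectiveˡ eq) a<c)

  toList-injective : ∀ {A : Set} {n} {u v : Vec A n} → toList u ≡ toList v → u ≡ v
  toList-injective {u = u} {v} eq =
    trans (sym (Vecₚ.cast-is-id refl u)) (Vecₚ.toList-injective refl u v eq)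

  concat-injective : ∀ {A : Set} {n k} (F G : Vec (Vec A k) n) →
                     Vec.concat F ≡ Vec.concat G → F ≡ G
  concat-injective []      []      _  = refl
  concat-injective (C ∷ F) (D ∷ G) eq =
    let C≡D , F≡G = Vecₚ.++-injective C D eq in cong₂ _∷_ C≡D (concat-injective F G F≡G)

  entries-injective : ∀ {n k} {F G : Array n k} → entries F ≡ entries G → F ≡ G
  entries-injective {F = F} {G} eq = concat-injective F G (toList-injective eq)

  entries-red : ∀ {n k} (F : Array n k) → entries (red F) ≡ map (rank (entries F)) (entries F)
  entries-red F = trans (cong toList (sym (Vecₚ.map-concat (rank (entries F)) F)))
                        (Vecₚ.toList-map (rank (entries F)) (Vec.concat F))

  entries₂ : ∀ {k} (C C′ : Vec ℕ k) → entries (C ∷ C′ ∷ []) ≡ toList C ++ toList C′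
  entries₂ C C′ = trans (entries-∷ C (C′ ∷ []))
    (cong (toList C ++_) (trans (entries-∷ C′ []) (Listₚ.++-identityʳ (toList C′))))

  ascending-entries₂ : ∀ {k} {C C′ : Vec ℕ k} → Ascending (toList C) → Ascending (toList C′) →
                       Before C C′ → Ascending (entries (C ∷ C′ ∷ []))
  ascending-entries₂ {C = C} {C′} C↑ C′↑ C<C′ =
    subst Ascending (sym (entries₂ C C′)) (AllPairsₚ.++⁺ C↑ C′↑ C<C′)

  length-entries : ∀ {n k} (F : Array n k) → length (entries F) ≡ n * k
  length-entries F = Vecₚ.length-toList (Vec.concat F)

  -- Counting the positions that satisfy Q, position zero split off.
  module _ {n} {Q : Pred (Fin (suc n)) 0ℓ} (Q? : Decidable Q) where

    private
      tail-filter : length (filter Q? (List.tabulate Fin.suc)) ≡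
                    length (filter (λ i → Q? (Fin.suc i)) (List.allFin n))
      tail-filter = trans (cong (λ l → length (filter Q? l))
                                (sym (Listₚ.map-tabulate (λ i → i) Fin.suc)))
                          (go (List.allFin n))
        where
        go : ∀ is → length (filter Q? (map Fin.suc is)) ≡ length (filter (λ i → Q? (Fin.suc i)) is)
        go []       = refl
        go (i ∷ is) with does (Q? (Fin.suc i))
        ... | true  = cong suc (go is)
        ... | false = go is

    length-filter-allFin-accept : Q Fin.zero →
      length (filter Q? (List.allFin (suc n))) ≡
      suc (length (filter (λ i → Q? (Fin.suc i)) (List.allFin n)))
    length-filter-allFin-accept q₀ =
      trans (cong length (Listₚ.filter-accept Q? q₀)) (cong suc tail-filter)

    length-filter-allFin-reject : ¬ Q Fin.zero →
      length (filter Q? (List.allFin (suc n))) ≡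
      length (filter (λ i → Q? (Fin.suc i)) (List.allFin n))
    length-filter-allFin-reject ¬q₀ =
      trans (cong length (Listₚ.filter-reject Q? ¬q₀)) tail-filter

  -- The pattern P: its columns are low = 1, …, k and high = k + 1, …, 2 k.
  module Pattern {k} {P : Array 2 k} (P-std : IsStandardTableau₂ P)
           (P₀ : Vec.head P ≡ Vec.tabulate (λ i → suc (Fin.toℕ i))) where

    low high : Vec ℕ k
    low  = Vec.head P
    high = Vec.head (Vec.tail P)

    P≡ : P ≡ low ∷ high ∷ []
    P≡ = η P
      where
      η : ∀ (Q : Array 2 k) → Q ≡ Vec.head Q ∷ Vec.head (Vec.tail Q) ∷ []
      η (_ ∷ _ ∷ []) = refl

    P↑ : Increasing low × Increasing high
    P↑ = VecAll.head columns↑ , VecAll.head (VecAll.tail columns↑)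
      where columns↑ = subst (VecAll.All Increasing) P≡ (proj₂ (proj₂ (proj₁ P-std)))

    entries-P : entries P ≡ toList low ++ toList high
    entries-P = trans (cong entries P≡) (entries₂ low high)

    low≤k : All (_≤ k) (toList low)
    low≤k = subst (λ C → All (_≤ k) (toList C)) (sym P₀)
      (VecAllₚ.toList⁺ (VecAllₚ.tabulate⁺ Finₚ.toℕ<n))

    ∈low : ∀ {v} → 1 ≤ v → v ≤ k → v ∈ toList low
    ∈low {suc v} _ v<k = subst (λ C → suc v ∈ toList C) (sym P₀)
      (subst (λ w → suc w ∈ toList (Vec.tabulate (λ i → suc (Fin.toℕ i)))) (Finₚ.toℕ-fromℕ< v<k)
        (∈-toList⁺ (∈-tabulate⁺ (λ i → suc (Fin.toℕ i)) (Fin.fromℕ< v<k))))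

    bounds : All (λ v → 1 ≤ v × v ≤ k * 2) (entries P)
    bounds = proj₁ (proj₁ P-std)

    k<high : All (k <_) (toList high)
    k<high = All.tabulate λ {v} v∈ → ≰⇒> λ v≤k →
      let v∈P = subst (v ∈_) (sym entries-P) (∈-++⁺ʳ (toList low) v∈)
      in ++-unique⁻ (toList low) (subst Unique entries-P (proj₁ (proj₂ (proj₁ P-std))))
           (∈low (proj₁ (All.lookup bounds v∈P)) v≤k , v∈)

    low<high : Before low high
    low<high = All.map (λ c≤k → All.map (≤-<-trans c≤k) k<high) low≤k

    entries-P-ascending : Ascending (entries P)
    entries-P-ascending = subst (λ Q → Ascending (entries Q)) (sym P≡) (ascending-entries₂
      (increasing⇒ascending (proj₁ P↑)) (increasing⇒ascending (proj₂ P↑)) low<high)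

    -- So P is read off column by column as 1, …, 2 k.
    entries-P-range : entries P ≡ rangeFrom 0 (length (entries P))
    entries-P-range = ascending-range 0 entries-P-ascending (All.map proj₁ bounds)
      (subst (λ N → All (_≤ N) (entries P)) (trans (*-comm k 2) (sym (length-entries P)))
        (All.map proj₂ bounds))

    -- If red (C ∷ C′ ∷ []) ≡ P, the ranks of the entries of C are at most k and
    -- those of the entries of C′ exceed k, and ranks are monotone.
    match⇒before : ∀ {C C′} → red (C ∷ C′ ∷ []) ≡ P → Before C C′
    match⇒before {C} {C′} eq =
      All.map (λ c≤k → All.map (λ k<c′ → ≰⇒> λ c′≤c →
        <⇒≱ (≤-<-trans c≤k k<c′) (rank-mono L c′≤c)) ranks′) ranks
      where
      L = entries (C ∷ C′ ∷ [])
      ranks : All (λ c → rank L c ≤ k) (toList C)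
      ranks = Allₚ.map⁻ (subst (All (_≤ k)) (Vecₚ.toList-map (rank L) C)
        (subst (λ Q → All (_≤ k) (toList (Vec.head Q))) (sym eq) low≤k))
      ranks′ : All (λ c → k < rank L c) (toList C′)
      ranks′ = Allₚ.map⁻ (subst (All (k <_)) (Vecₚ.toList-map (rank L) C′)
        (subst (λ Q → All (k <_) (toList (Vec.head (Vec.tail Q)))) (sym eq) k<high))

    -- If C < C′, the entries of C followed by those of C′ are ascending, so their
    -- ranks are 1, …, 2 k in order, as in P.
    before⇒match : ∀ {C C′} → Ascending (toList C) → Ascending (toList C′) →
                   Before C C′ → red (C ∷ C′ ∷ []) ≡ P
    before⇒match {C} {C′} C↑ C′↑ C<C′ = entries-injective (begin
      entries (red F)                  ≡⟨ entries-red F ⟩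
      map (rank (entries F)) (entries F)
        ≡⟨ ascending-rank 0 (ascending-entries₂ C↑ C′↑ C<C′) ⟩
      rangeFrom 0 (length (entries F))
        ≡⟨ cong (rangeFrom 0) (trans (length-entries F) (sym (length-entries P))) ⟩
      rangeFrom 0 (length (entries P)) ≡⟨ entries-P-range ⟨
      entries P                        ∎)
      where
      open ≡-Reasoning
      F = C ∷ C′ ∷ []

    mch-before : ∀ {n C C′} (F : Array n k) → Ascending (toList C) → Ascending (toList C′) →
                 Before C C′ → mch P (C ∷ C′ ∷ F) ≡ suc (mch P (C′ ∷ F))
    mch-before F C↑ C′↑ C<C′ =
      length-filter-allFin-accept (λ i → red ((_ ∷ _ ∷ F) [ i ,+1]) Defs.≟ P)
        (before⇒match C↑ C′↑ C<C′)

    mch-¬before : ∀ {n C C′} (F : Array n k) → ¬ Before C C′ →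
                  mch P (C ∷ C′ ∷ F) ≡ mch P (C′ ∷ F)
    mch-¬before F C≮C′ =
      length-filter-allFin-reject (λ i → red ((_ ∷ _ ∷ F) [ i ,+1]) Defs.≟ P) (C≮C′ ∘ match⇒before)

  before-∷ : ∀ {r k a} (U : Vec ℕ r) (C : Vec ℕ k) → All (a <_) (toList C) →
             Before (a ∷ U) C ⇔ Before U C
  before-∷ U C a<C = mk⇔ All.tail (a<C ∷_)

  -- For W ascending, W < C depends only on the largest entry of W, which is
  -- kept when the first r entries are dropped.
  before-drop : ∀ r {k l} {W : Vec ℕ (r + suc k)} (C : Vec ℕ l) → Ascending (toList W) →
                Before (Vec.drop r W) C ⇔ Before W C
  before-drop r C W↑ = mk⇔ (to r W↑) (VecAllₚ.toList⁺ ∘ VecAllₚ.drop⁺ r ∘ VecAllₚ.toList⁻)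
    where
    to : ∀ r {k} {W : Vec ℕ (r + suc k)} → Ascending (toList W) →
         Before (Vec.drop r W) C → Before W C
    to zero    W↑ W<C = W<C
    to (suc r) {W = a ∷ W} (a<W ∷ W↑) drop<C =
      All.map (<-trans a<w) w<C ∷ to r W↑ drop<C
      where
      all-head : ∀ {p n} {Q : Pred ℕ p} {V : Vec ℕ (suc n)} → VecAll.All Q V → Q (Vec.head V)
      all-head (q ∷ _) = q
      a<w : a < Vec.head (Vec.drop r W)
      a<w = all-head (VecAllₚ.drop⁺ r (VecAllₚ.toList⁻ a<W))
      w<C : All (Vec.head (Vec.drop r W) <_) (toList C)
      w<C = all-head (VecAllₚ.toList⁻ drop<C)

open Combinatorics

-- Finite sums

module Sums {c ℓ} (R : CommutativeRing c ℓ) where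
  open CommutativeRing R
  open import Algebra.Properties.CommutativeSemigroup +-commutativeSemigroup
    using (interchange; x∙yz≈y∙xz)
  open import Algebra.Definitions.RawMonoid +-rawMonoid using () renaming (_×_ to _·_) public

  ∑ : ∀ {a} {A : Set a} → List A → (A → Carrier) → Carrier
  ∑ xs f = foldr _+_ 0# (map f xs)

  module _ {a} {A : Set a} where

    ∑-cong : ∀ {xs : List A} {f g : A → Carrier} →
             All (λ v → f v ≈ g v) xs → ∑ xs f ≈ ∑ xs g
    ∑-cong []       = refl
    ∑-cong (p ∷ ps) = +-cong p (∑-cong ps)

    ∑-cong′ : ∀ (xs : List A) {f g : A → Carrier} → (∀ v → f v ≈ g v) → ∑ xs f ≈ ∑ xs g
    ∑-cong′ xs f≈g = ∑-cong (All.universal f≈g xs)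

    ∑-++ : ∀ (xs : List A) {ys} f → ∑ (xs ++ ys) f ≈ ∑ xs f + ∑ ys f
    ∑-++ []       f = sym (+-identityˡ _)
    ∑-++ (x ∷ xs) f = trans (+-congˡ (∑-++ xs f)) (sym (+-assoc _ _ _))

    ∑-map : ∀ {b} {B : Set b} (h : B → A) ys f → ∑ (map h ys) f ≈ ∑ ys (f ∘ h)
    ∑-map h ys f = reflexive (≡.cong (foldr _+_ 0#) (≡.sym (Listₚ.map-∘ ys)))

    ∑-concatMap : ∀ {b} {B : Set b} (h : B → List A) ys f →
                  ∑ (concatMap h ys) f ≈ ∑ ys (λ y → ∑ (h y) f)
    ∑-concatMap h []       f = refl
    ∑-concatMap h (y ∷ ys) f = trans (∑-++ (h y) f) (+-congˡ (∑-concatMap h ys f))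

    ∑-+ : ∀ (xs : List A) f g → ∑ xs (λ v → f v + g v) ≈ ∑ xs f + ∑ xs g
    ∑-+ []       f g = sym (+-identityˡ 0#)
    ∑-+ (x ∷ xs) f g = trans (+-congˡ (∑-+ xs f g)) (interchange _ _ _ _)

    ∑-*ˡ : ∀ c (xs : List A) f → ∑ xs (λ v → c * f v) ≈ c * ∑ xs f
    ∑-*ˡ c []       f = sym (zeroʳ c)
    ∑-*ˡ c (x ∷ xs) f = trans (+-congˡ (∑-*ˡ c xs f)) (sym (distribˡ c _ _))

    ∑-zero : ∀ {xs : List A} {f} → All (λ v → f v ≈ 0#) xs → ∑ xs f ≈ 0#
    ∑-zero []       = refl
    ∑-zero (p ∷ ps) = trans (+-cong p (∑-zero ps)) (+-identityˡ 0#)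

    ∑-const : ∀ (xs : List A) c → ∑ xs (λ _ → c) ≈ (length xs · 1#) * c
    ∑-const []       c = sym (zeroˡ c)
    ∑-const (x ∷ xs) c =
      trans (+-cong (sym (*-identityˡ c)) (∑-const xs c)) (sym (distribʳ c _ _))

    ∑-↭ : ∀ {xs ys : List A} f → xs ↭ ys → ∑ xs f ≈ ∑ ys f
    ∑-↭ f Perm.refl         = refl
    ∑-↭ f (Perm.prep v p)   = +-congˡ (∑-↭ f p)
    ∑-↭ f (Perm.swap v w p) = trans (+-congˡ (+-congˡ (∑-↭ f p))) (x∙yz≈y∙xz _ _ _)
    ∑-↭ f (Perm.trans p q)  = trans (∑-↭ f p) (∑-↭ f q)

  -- v if the decided statement holds, and 0 otherwise.
  when : ∀ {a} {A : Set a} → Dec A → Carrier → Carrier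
  when a? v = if does a? then v else 0#

  when-⇔ : ∀ {a b} {A : Set a} {B : Set b} → A ⇔ B → (a? : Dec A) (b? : Dec B) →
           ∀ v → when a? v ≈ when b? v
  when-⇔ A⇔B a? b? v = reflexive (≡.cong (if_then v else 0#) (does-⇔ A⇔B a? b?))

  when-no : ∀ {a} {A : Set a} → ¬ A → (a? : Dec A) → ∀ v → when a? v ≈ 0#
  when-no ¬a a? v = reflexive (≡.cong (if_then v else 0#) (dec-false a? ¬a))

module _ {c ℓ} (R : CommutativeRing c ℓ) where
  open CommutativeRing R
  open Sums R
  open import Relation.Binary.Reasoning.Setoid setoid

  ∑-splits-∷ : ∀ r a S (f : Vec ℕ (suc r) × List ℕ → Carrier) →
    ∑ (splits (suc r) (a ∷ S)) f ≈
    ∑ (splits r S) (λ (U , T) → f (a ∷ U , T)) +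
    ∑ (splits (suc r) S) (λ (U , T) → f (U , a ∷ T))
  ∑-splits-∷ r a S f = trans (∑-++ (map _ (splits r S)) f)
    (+-cong (∑-map _ (splits r S) f) (∑-map _ (splits (suc r) S) f))

  -- A set U with |U| = r, followed by a set C with |C| = k + 1, U < C, is the
  -- same as their union W; C consists of the last k + 1 elements of W.  The sum is
  -- over pairs of U and C on the left, over W on the right, and T′ is the
  -- complement of the union in S.
  ∑-splits-merge : ∀ r k {S} → Ascending S → (h : Vec ℕ (suc k) → List ℕ → Carrier) →
    ∑ (splits r S) (λ (U , T) → ∑ (splits (suc k) T) (λ (C , T′) → when (before? U C) (h C T′)))
    ≈ ∑ (splits (r ℕ.+ suc k) S) (λ (W , T′) → h (Vec.drop r W) T′)
  ∑-splits-merge zero    k S↑ h = +-identityʳ _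
  ∑-splits-merge (suc r) k [] h = refl
  ∑-splits-merge (suc r) k {a ∷ S} (a<S ∷ S↑) h = begin
    ∑ (splits (suc r) (a ∷ S)) inner
      ≈⟨ ∑-splits-∷ r a S inner ⟩
    ∑ (splits r S) (λ (U , T) → inner (a ∷ U , T)) +
    ∑ (splits (suc r) S) (λ (U , T) → inner (U , a ∷ T))
      ≈⟨ +-cong (∑-cong (All.map with-a (splits-All r a<S)))
                (∑-cong (All.map without-a (splits-All (suc r) a<S))) ⟩
    ∑ (splits r S) (λ (U , T) → ∑ (splits (suc k) T) (λ (C , T′) → when (before? U C) (h C T′))) +
    ∑ (splits (suc r) S) (λ (U , T) →
      ∑ (splits (suc k) T) (λ (C , T′) → when (before? U C) (h C (a ∷ T′))))
      ≈⟨ +-cong (∑-splits-merge r k S↑ h) (∑-splits-merge (suc r) k S↑ (λ C T′ → h C (a ∷ T′))) ⟩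
    ∑ (splits (r ℕ.+ suc k) S) (λ (W , T′) → h (Vec.drop r W) T′) +
    ∑ (splits (suc r ℕ.+ suc k) S) (λ (W , T′) → h (Vec.drop (suc r) W) (a ∷ T′))
      ≈⟨ ∑-splits-∷ (r ℕ.+ suc k) a S (λ (W , T′) → h (Vec.drop (suc r) W) T′) ⟨
    ∑ (splits (suc r ℕ.+ suc k) (a ∷ S)) (λ (W , T′) → h (Vec.drop (suc r) W) T′) ∎
    where
    inner : Vec ℕ (suc r) × List ℕ → Carrier
    inner (U , T) = ∑ (splits (suc k) T) (λ (C , T′) → when (before? U C) (h C T′))

    -- The least element a of S lies in U: then U < C is unaffected by a.
    with-a : ∀ {p : Vec ℕ r × List ℕ} → let (U , T) = p in
      All (a <_) (toList U) × All (a <_) T →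
      inner (a ∷ U , T) ≈ ∑ (splits (suc k) T) (λ (C , T′) → when (before? U C) (h C T′))
    with-a {U , T} (_ , a<T) = ∑-cong (All.map
      (λ {(C , T′)} (a<C , _) → 
        when-⇔ (before-∷ U C a<C) (before? (a ∷ U) C) (before? U C) (h C T′))
      (splits-All (suc k) a<T))

    -- The least element a of S is not in U: then a cannot be in C, since U is
    -- not empty and U < C.
    without-a : ∀ {p : Vec ℕ (suc r) × List ℕ} → let (U , T) = p in
      All (a <_) (toList U) × All (a <_) T →
      inner (U , a ∷ T) ≈ ∑ (splits (suc k) T) (λ (C , T′) → when (before? U C) (h C (a ∷ T′)))
    without-a {u ∷ U , T} (a<u ∷ _ , _) = begin
      inner (u ∷ U , a ∷ T)
        ≈⟨ ∑-splits-∷ k a T (λ (C , T′) → when (before? (u ∷ U) C) (h C T′)) ⟩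
      ∑ (splits k T) (λ (C , T′) → when (before? (u ∷ U) (a ∷ C)) (h (a ∷ C) T′)) + _
        ≈⟨ +-congʳ (∑-zero (All.universal (λ (C , T′) → when-no
             (λ { ((u<a ∷ _) ∷ _) → ℕₚ.<-asym a<u u<a }) (before? (u ∷ U) (a ∷ C)) _)
             (splits k T))) ⟩
      0# + _
        ≈⟨ +-identityˡ _ ⟩
      ∑ (splits (suc k) T) (λ (C , T′) → when (before? (u ∷ U) C) (h C (a ∷ T′))) ∎

-- The recurrence for weighted counts of fillings

module _ {c ℓ} (R : CommutativeRing c ℓ) where
  open CommutativeRing R

  -- The columns have k′ + 1 cells, since k ≥ 1.
  module Count {k′} {P : Array 2 (suc k′)} (P-std : IsStandardTableau₂ P)
    (P₀ : Vec.head P ≡ Vec.tabulate (λ i → suc (Fin.toℕ i)))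
    (x y : Carrier) (x≈1+y : x ≈ 1# + y) where

    open Sums R
    open Pattern P-std P₀
    open import Algebra.Definitions.RawSemiring (RawRing.rawSemiring rawRing) using (_^_)
    open import Relation.Binary.Reasoning.Setoid setoid

    private
      k = suc k′

    -- The fillings of n columns by T, weighted by x to the number of matches.
    weight : ℕ → List ℕ → Carrier
    weight n T = ∑ (fillings n k T) (λ F → x ^ mch P F)

    -- The same with a further column C in front, whose match counts too.
    weightAfter : ∀ n → Vec ℕ k → List ℕ → Carrier
    weightAfter n C T = ∑ (fillings n k T) (λ F → x ^ mch P (C ∷ F))

    ∑-fillings-suc : ∀ n T (f : Array (suc n) k → Carrier) →
      ∑ (fillings (suc n) k T) f ≈
      ∑ (splits k T) (λ (C , T′) → ∑ (fillings n k T′) (λ F → f (C ∷ F)))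
    ∑-fillings-suc n T f = trans (∑-concatMap _ (splits k T) f)
      (∑-cong′ (splits k T) (λ (C , T′) → ∑-map (C ∷_) (fillings n k T′) f))

    -- The factor of the first pair of columns is 1, or 1 + y in case of a match.
    x^-mch : ∀ {n C C′} → Ascending (toList C) → Ascending (toList C′) → (F : Array n k) →
             x ^ mch P (C ∷ C′ ∷ F) ≈
             x ^ mch P (C′ ∷ F) + y * when (before? C C′) (x ^ mch P (C′ ∷ F))
    x^-mch {n} {C} {C′} C↑ C′↑ F with before? C C′
    ... | yes C<C′ = begin
      x ^ mch P (C ∷ C′ ∷ F)    ≡⟨ ≡.cong (x ^_) (mch-before F C↑ C′↑ C<C′) ⟩
      x * x ^ mch P (C′ ∷ F)    ≈⟨ *-congʳ x≈1+y ⟩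
      (1# + y) * x ^ mch P (C′ ∷ F)   ≈⟨ distribʳ _ 1# y ⟩
      1# * x ^ mch P (C′ ∷ F) + y * x ^ mch P (C′ ∷ F)   ≈⟨ +-congʳ (*-identityˡ _) ⟩
      x ^ mch P (C′ ∷ F) + y * x ^ mch P (C′ ∷ F)   ∎
    ... | no C≮C′ = begin
      x ^ mch P (C ∷ C′ ∷ F)    ≡⟨ ≡.cong (x ^_) (mch-¬before F C≮C′) ⟩
      x ^ mch P (C′ ∷ F)        ≈⟨ +-identityʳ _ ⟨
      x ^ mch P (C′ ∷ F) + 0#   ≈⟨ +-congˡ (zeroʳ y) ⟨
      x ^ mch P (C′ ∷ F) + y * 0# ∎

    ∑-when : ∀ {a b} {A : Set a} {B : Set b} (b? : Dec B) (xs : List A) f →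
             ∑ xs (λ v → when b? (f v)) ≈ when b? (∑ xs f)
    ∑-when b? xs f with does b?
    ... | true  = refl
    ... | false = ∑-zero (All.universal (λ _ → refl) xs)

    weightAfter-suc : ∀ n {C T} → Ascending (toList C) → Ascending T →
      weightAfter (suc n) C T ≈
      weight (suc n) T +
      y * ∑ (splits k T) (λ (C′ , T′) → when (before? C C′) (weightAfter n C′ T′))
    weightAfter-suc n {C} {T} C↑ T↑ = begin
      weightAfter (suc n) C T
        ≈⟨ ∑-fillings-suc n T (λ F → x ^ mch P (C ∷ F)) ⟩
      ∑ (splits k T) (λ (C′ , T′) → ∑ (fillings n k T′) (λ F → x ^ mch P (C ∷ C′ ∷ F)))
        ≈⟨ ∑-cong (All.map pointwise (splits-ascending k T↑)) ⟩
      ∑ (splits k T) (λ (C′ , T′) →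
        weightAfter n C′ T′ + y * when (before? C C′) (weightAfter n C′ T′))
        ≈⟨ ∑-+ (splits k T) _ _ ⟩
      ∑ (splits k T) (λ (C′ , T′) → weightAfter n C′ T′) +
      ∑ (splits k T) (λ (C′ , T′) → y * when (before? C C′) (weightAfter n C′ T′))
        ≈⟨ +-cong (sym (∑-fillings-suc n T (λ F → x ^ mch P F))) (∑-*ˡ y (splits k T) _) ⟩
      weight (suc n) T +
      y * ∑ (splits k T) (λ (C′ , T′) → when (before? C C′) (weightAfter n C′ T′)) ∎
      where
      pointwise : ∀ {p : Vec ℕ k × List ℕ} → let (C′ , T′) = p in
        Ascending (toList C′) × Ascending T′ →
        ∑ (fillings n k T′) (λ F → x ^ mch P (C ∷ C′ ∷ F)) ≈
        weightAfter n C′ T′ + y * when (before? C C′) (weightAfter n C′ T′)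
      pointwise {C′ , T′} (C′↑ , _) = begin
        ∑ (fillings n k T′) (λ F → x ^ mch P (C ∷ C′ ∷ F))
          ≈⟨ ∑-cong′ (fillings n k T′) (x^-mch C↑ C′↑) ⟩
        ∑ (fillings n k T′) (λ F →
            x ^ mch P (C′ ∷ F) + y * when (before? C C′) (x ^ mch P (C′ ∷ F)))
          ≈⟨ ∑-+ (fillings n k T′) _ _ ⟩
        weightAfter n C′ T′ +
        ∑ (fillings n k T′) (λ F → y * when (before? C C′) (x ^ mch P (C′ ∷ F)))
          ≈⟨ +-congˡ (trans (∑-*ˡ y (fillings n k T′) _)
                            (*-congˡ (∑-when (before? C C′) (fillings n k T′) _))) ⟩
        weightAfter n C′ T′ + y * when (before? C C′) (weightAfter n C′ T′) ∎

    -- In both sums U runs over the r-subsets of S, in the role of the union of a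
    -- chain of columns.  chain r n S counts its continuations by a column C with
    -- U < C and n further columns, weighted by the matches among these n + 1
    -- columns; free r n S counts its continuations by n weighted columns, with no
    -- condition between them and U.
    chain : ℕ → ℕ → List ℕ → Carrier
    chain r n S = ∑ (splits r S) (λ (U , T) →
      ∑ (splits k T) (λ (C , T′) → when (before? U C) (weightAfter n C T′)))

    free : ℕ → ℕ → List ℕ → Carrier
    free r n S = ∑ (splits r S) (λ (U , T) → weight n T)

    weight-suc : ∀ n T → weight (suc n) T ≈ chain 0 n T
    weight-suc n T = trans (∑-fillings-suc n T (λ F → x ^ mch P F)) (sym (+-identityʳ _))

    chain-zero : ∀ r {S} → Ascending S → chain r 0 S ≈ free (r ℕ.+ k) 0 S
    chain-zero r S↑ = ∑-splits-merge R r k′ S↑ (weightAfter 0)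

    chain-suc : ∀ r n {S} → Ascending S →
                chain r (suc n) S ≈ free (r ℕ.+ k) (suc n) S + y * chain (r ℕ.+ k) n S
    chain-suc r n {S} S↑ = begin
      chain r (suc n) S
        ≈⟨ ∑-splits-merge R r k′ S↑ (weightAfter (suc n)) ⟩
      ∑ (splits (r ℕ.+ k) S) (λ (W , T) → weightAfter (suc n) (Vec.drop r W) T)
        ≈⟨ ∑-cong (All.map pointwise (splits-ascending (r ℕ.+ k) S↑)) ⟩
      ∑ (splits (r ℕ.+ k) S) (λ (W , T) → weight (suc n) T +
        y * ∑ (splits k T) (λ (C , T′) → when (before? W C) (weightAfter n C T′)))
        ≈⟨ trans (∑-+ (splits (r ℕ.+ k) S) _ _) (+-congˡ (∑-*ˡ y (splits (r ℕ.+ k) S) _)) ⟩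
      free (r ℕ.+ k) (suc n) S + y * chain (r ℕ.+ k) n S ∎
      where
      pointwise : ∀ {p : Vec ℕ (r ℕ.+ k) × List ℕ} → let (W , T) = p in
        Ascending (toList W) × Ascending T →
        weightAfter (suc n) (Vec.drop r W) T ≈ weight (suc n) T +
        y * ∑ (splits k T) (λ (C , T′) → when (before? W C) (weightAfter n C T′))
      pointwise {W , T} (W↑ , T↑) = trans (weightAfter-suc n (drop-ascending r W↑) T↑)
        (+-congˡ (*-congˡ (∑-cong′ (splits k T) (λ (C , T′) →
          when-⇔ (before-drop r C W↑) (before? (Vec.drop r W) C) (before? W C) _))))
        where
        drop-ascending : ∀ r {k} {W : Vec ℕ (r ℕ.+ k)} → Ascending (toList W) →
                         Ascending (toList (Vec.drop r W))
        drop-ascending zero    W↑ = W↑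
        drop-ascending (suc r) {W = _ ∷ _} (_ ∷ W↑) = drop-ascending r W↑

    -- w n is the inverse of n !.
    module Evaluate (w : ℕ → Carrier) (w-! : ∀ n → w n * ((n !) · 1#) ≈ 1#) where
      open SeriesRing R
      open PowerSeries rawRing
      open import Algebra.Properties.Semiring.Mult semiring using (×1-homo-*)
      open import Algebra.Properties.CommutativeSemigroup *-commutativeSemigroup
        using (x∙yz≈y∙xz)
      open import Algebra.Properties.Ring ring using (-‿distribˡ-*)
      open import Algebra.Properties.Group +-group using (inverseˡ-unique)

      -- coeffs r i = yⁱ / (r + k i)!, the weight of having extended a union of r
      -- elements by a chain of i columns.
      coeffs : ℕ → Series
      coeffs r i = y ^ i * w (r ℕ.+ k ℕ.* i)

      coeffs-zero : ∀ r → coeffs r 0 ≈ w r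
      coeffs-zero r = trans (*-identityˡ _)
        (reflexive (≡.cong w (≡.trans (≡.cong (r ℕ.+_) (ℕₚ.*-zeroʳ k)) (ℕₚ.+-identityʳ r))))

      coeffs-suc : ∀ r i → coeffs r (suc i) ≈ y * coeffs (r ℕ.+ k) i
      coeffs-suc r i = trans (*-assoc y (y ^ i) _) (*-congˡ (*-congˡ (reflexive (≡.cong w
        (≡.trans (≡.cong (r ℕ.+_) (ℕₚ.*-suc k i)) (≡.sym (ℕₚ.+-assoc r k (k ℕ.* i))))))))

      -- q is later the quotient of den 0 by the series den.
      module _ (q : Series) (q-zero : q 0 ≈ 1#)
               (q-suc : ∀ n → q (suc n) ≈ (coeffs k ⊛ q) n) where

        -- The value of the weighted count for n columns: it depends on T through its
        -- size alone.
        Evaluates : ℕ → Set _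
        Evaluates n = ∀ {T} → Ascending T → length T ≡ k ℕ.* n →
                      weight n T ≈ (((k ℕ.* n) !) · 1#) * q n

        -- The sum has |S|! / (r! (k n)!) terms, and each is (k n)! qₙ.
        free-value : ∀ n → Evaluates n → ∀ r {S} → Ascending S → length S ≡ r ℕ.+ k ℕ.* n →
                     free r n S ≈ ((length S !) · 1#) * (w r * q n)
        free-value n value r {S} S↑ |S|≡ = begin
          free r n S
            ≈⟨ ∑-cong (All.zipWith pointwise (splits-↭ r S , splits-ascending r S↑)) ⟩
          ∑ (splits r S) (λ _ → m! * q n)
            ≈⟨ ∑-const (splits r S) _ ⟩
          s * (m! * q n)
            ≈⟨ *-congˡ (*-identityˡ _) ⟨
          s * (1# * (m! * q n))
            ≈⟨ *-congˡ (*-congʳ (w-! r)) ⟨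
          s * ((w r * r!) * (m! * q n))
            ≈⟨ regroup s (w r) r! m! (q n) ⟩
          (s * (r! * m!)) * (w r * q n)
            ≈⟨ *-congʳ (trans (*-congˡ (sym (×1-homo-* (r !) ((k ℕ.* n) !))))
                 (sym (×1-homo-* (length (splits r S)) (r ! ℕ.* (k ℕ.* n) !)))) ⟩
          ((length (splits r S) ℕ.* (r ! ℕ.* (k ℕ.* n) !)) · 1#) * (w r * q n)
            ≡⟨ ≡.cong (λ l → (l · 1#) * (w r * q n)) (splits-! r (k ℕ.* n) S |S|≡) ⟩
          ((length S !) · 1#) * (w r * q n) ∎
          where
          s  = length (splits r S) · 1#
          r! = (r !) · 1#
          m! = ((k ℕ.* n) !) · 1#
          regroup : ∀ a b c d e → a * ((b * c) * (d * e)) ≈ (a * (c * d)) * (b * e)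
          regroup = solve 5 (λ a b c d e →
            a :* ((b :* c) :* (d :* e)) := (a :* (c :* d)) :* (b :* e)) refl
            where open import Algebra.Solver.Ring.NaturalCoefficients.Default commutativeSemiring
          pointwise : ∀ {p : Vec ℕ r × List ℕ} → let (U , T) = p in
            toList U ++ T ↭ S × (Ascending (toList U) × Ascending T) →
            weight n T ≈ m! * q n
          pointwise {U , T} (UT↭S , (_ , T↑)) = value T↑ (ℕₚ.+-cancelˡ-≡ r _ _ (≡.trans
            (≡.sym (≡.trans (Listₚ.length-++ (toList U))
              (≡.cong (ℕ._+ length T) (Vecₚ.length-toList U))))
            (≡.trans (↭-length UT↭S) |S|≡)))

        -- Each step of chain-suc splits one term off the Cauchy product.
        chain-value : ∀ n → (∀ m → m ≤ n → Evaluates m) → ∀ r {S} → Ascending S →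
                      length S ≡ (r ℕ.+ k) ℕ.+ k ℕ.* n →
                      chain r n S ≈ ((length S !) · 1#) * (coeffs (r ℕ.+ k) ⊛ q) n
        chain-value zero    values r {S} S↑ |S|≡ = begin
          chain r 0 S
            ≈⟨ chain-zero r S↑ ⟩
          free (r ℕ.+ k) 0 S
            ≈⟨ free-value 0 (values 0 ℕ.z≤n) (r ℕ.+ k) S↑ |S|≡ ⟩
          ((length S !) · 1#) * (w (r ℕ.+ k) * q 0)
            ≈⟨ *-congˡ (*-congʳ (coeffs-zero (r ℕ.+ k))) ⟨
          ((length S !) · 1#) * (coeffs (r ℕ.+ k) 0 * q 0) ∎
        chain-value (suc n) values r {S} S↑ |S|≡ = begin
          chain r (suc n) S
            ≈⟨ chain-suc r n S↑ ⟩
          free (r ℕ.+ k) (suc n) S + y * chain (r ℕ.+ k) n S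
            ≈⟨ +-cong
                 (free-value (suc n) (values (suc n) ℕₚ.≤-refl) (r ℕ.+ k) S↑ |S|≡)
                 (*-congˡ (chain-value n (λ m m≤n → values m (ℕₚ.m≤n⇒m≤1+n m≤n))
                    (r ℕ.+ k) S↑ |S|≡′)) ⟩
          N! * (w (r ℕ.+ k) * q (suc n)) + y * (N! * (coeffs (r ℕ.+ k ℕ.+ k) ⊛ q) n)
            ≈⟨ +-cong (*-congˡ (*-congʳ (sym (coeffs-zero (r ℕ.+ k)))))
                      (trans (x∙yz≈y∙xz y N! _) (*-congˡ (sym tail-value))) ⟩
          N! * (coeffs (r ℕ.+ k) 0 * q (suc n)) + N! * ((coeffs (r ℕ.+ k) ∘ suc) ⊛ q) n
            ≈⟨ distribˡ N! _ _ ⟨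
          N! * (coeffs (r ℕ.+ k) ⊛ q) (suc n) ∎
          where
          N! = (length S !) · 1#
          |S|≡′ : length S ≡ (r ℕ.+ k ℕ.+ k) ℕ.+ k ℕ.* n
          |S|≡′ = ≡.trans |S|≡ (≡.trans (≡.cong ((r ℕ.+ k) ℕ.+_) (ℕₚ.*-suc k n))
                    (≡.sym (ℕₚ.+-assoc (r ℕ.+ k) k (k ℕ.* n))))
          tail-value : ((coeffs (r ℕ.+ k) ∘ suc) ⊛ q) n ≈ y * (coeffs (r ℕ.+ k ℕ.+ k) ⊛ q) n
          tail-value = trans
            (⊛-cong {g = q} (coeffs-suc (r ℕ.+ k)) (λ _ → refl) n)
            (⊙-⊛ y (coeffs (r ℕ.+ k ℕ.+ k)) q n)

        weight-value : ∀ n → Evaluates n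
        weight-value n = go n n ℕₚ.≤-refl
          where
          go : ∀ n m → m ≤ n → Evaluates m
          go n zero _ {T} T↑ |T|≡ = begin
            1# + 0#                       ≈⟨ +-identityʳ 1# ⟩
            1#                            ≈⟨ trans (*-identityʳ _) (+-identityʳ 1#) ⟨
            ((0 !) · 1#) * 1#
              ≈⟨ *-cong (reflexive (≡.cong (λ l → (l !) · 1#) (≡.sym (ℕₚ.*-zeroʳ k))))
                        (sym q-zero) ⟩
            (((k ℕ.* 0) !) · 1#) * q 0 ∎
          go (suc n) (suc m) (s≤s m≤n) {T} T↑ |T|≡ = begin
            weight (suc m) T
              ≈⟨ weight-suc m T ⟩
            chain 0 m T
              ≈⟨ chain-value m (λ l l≤m → go n l (ℕₚ.≤-trans l≤m m≤n)) 0 T↑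
                   (≡.trans |T|≡ (ℕₚ.*-suc k m)) ⟩
            ((length T !) · 1#) * (coeffs k ⊛ q) m
              ≈⟨ *-cong (reflexive (≡.cong (λ l → (l !) · 1#) |T|≡)) (sym (q-suc m)) ⟩
            (((k ℕ.* suc m) !) · 1#) * q (suc m) ∎

        𝓕-value : ∀ n → w (k ℕ.* n) * ∑ (𝓕 n k) (λ F → x ^ mch P F) ≈ q n
        𝓕-value n = begin
          w (k ℕ.* n) * ∑ (𝓕 n k) (λ F → x ^ mch P F)
            ≈⟨ *-congˡ (∑-↭ _ (𝓕↭fillings n k)) ⟩
          w (k ℕ.* n) * weight n (range (k ℕ.* n))
            ≈⟨ *-congˡ (weight-value n (range-ascending _) (Listₚ.length-applyUpTo suc _)) ⟩
          w (k ℕ.* n) * ((((k ℕ.* n) !) · 1#) * q n)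
            ≈⟨ *-assoc _ _ _ ⟨
          (w (k ℕ.* n) * (((k ℕ.* n) !) · 1#)) * q n
            ≈⟨ trans (*-congʳ (w-! (k ℕ.* n))) (*-identityˡ (q n)) ⟩
          q n ∎

      -- Long division gives q den = den₀, whose coefficients beyond the constant one
      -- are zero.  With den₀ = - y this is the recurrence for q, after cancelling the
      -- unit den₀.
      quotient-value : ∀ (den : Series) (inv : Unit (den 0)) → den 0 ≈ - y →
        (∀ n → den (suc n) ≈ y ^ suc n * w (k ℕ.* suc n)) →
        (const (den 0) ÷ den [ inv ]) 0 ≈ 1# ×
        (∀ n → w (k ℕ.* n) * ∑ (𝓕 n k) (λ F → x ^ mch P F) ≈ (const (den 0) ÷ den [ inv ]) n)
      quotient-value den inv@(u , u*den₀≈1 , den₀*u≈1) den₀≈-y den-suc =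
        den₀*u≈1 , 𝓕-value q den₀*u≈1 q-suc
        where
        q : Series
        q = const (den 0) ÷ den [ inv ]
        den-tail : ∀ n → ((den ∘ suc) ⊛ q) n ≈ y * (coeffs k ⊛ q) n
        den-tail n = trans (⊛-cong {g = q} den-suc′ (λ _ → refl) n) (⊙-⊛ y (coeffs k) q n)
          where
          den-suc′ : ∀ i → den (suc i) ≈ y * coeffs k i
          den-suc′ i = trans (den-suc i) (trans
            (*-congˡ (reflexive (≡.cong w (ℕₚ.*-suc k i)))) (*-assoc y (y ^ i) _))
        q-suc : ∀ n → q (suc n) ≈ (coeffs k ⊛ q) n
        q-suc n = begin
          q (suc n)                  ≈⟨ *-identityˡ _ ⟨
          1# * q (suc n)             ≈⟨ *-congʳ u*den₀≈1 ⟨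
          (u * den 0) * q (suc n)    ≈⟨ *-assoc u _ _ ⟩
          u * (den 0 * q (suc n))    ≈⟨ *-congˡ cancelled ⟩
          u * (den 0 * (coeffs k ⊛ q) n)  ≈⟨ *-assoc u _ _ ⟨
          (u * den 0) * (coeffs k ⊛ q) n  ≈⟨ *-congʳ u*den₀≈1 ⟩
          1# * (coeffs k ⊛ q) n      ≈⟨ *-identityˡ _ ⟩
          (coeffs k ⊛ q) n           ∎
          where
          vanishes : den 0 * q (suc n) + y * (coeffs k ⊛ q) n ≈ 0#
          vanishes = begin
            den 0 * q (suc n) + y * (coeffs k ⊛ q) n  ≈⟨ +-congˡ (den-tail n) ⟨
            (den ⊛ q) (suc n)                         ≈⟨ ⊛-comm den q (suc n) ⟩
            (q ⊛ den) (suc n)                         ≈⟨ ÷-⊛ ring (const (den 0)) den inv (suc n) ⟩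
            0#                                        ∎
          cancelled : den 0 * q (suc n) ≈ den 0 * (coeffs k ⊛ q) n
          cancelled = begin
            den 0 * q (suc n)             ≈⟨ inverseˡ-unique _ _ vanishes ⟩
            - (y * (coeffs k ⊛ q) n)      ≈⟨ -‿distribˡ-* y _ ⟩
            (- y) * (coeffs k ⊛ q) n      ≈⟨ *-congʳ den₀≈-y ⟨
            den 0 * (coeffs k ⊛ q) n      ∎

-- Factorials, and counting by powers of zero

module _ {c ℓ} (R : CommutativeRing c ℓ) where
  open CommutativeRing R
  open Sums R
  open import Algebra.Definitions.RawSemiring (RawRing.rawSemiring rawRing) using (_^_)
  open import Algebra.Properties.Ring ring using (-‿+-comm; -‿involutive)
  open import Relation.Binary.Reasoning.Setoid setoid

  ∑-0^ : ∀ {a} {A : Set a} (f : A → ℕ) xs →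
         ∑ xs (λ v → 0# ^ f v) ≈ length (filter (λ v → f v ℕₚ.≟ 0) xs) · 1#
  ∑-0^ f []       = refl
  ∑-0^ f (v ∷ vs) = head-value (f v) ≡.refl
    where
    head-value : ∀ m → f v ≡ m → 0# ^ f v + ∑ vs (λ v → 0# ^ f v) ≈
                 length (filter (λ v → f v ℕₚ.≟ 0) (v ∷ vs)) · 1#
    head-value zero    eq = begin
      0# ^ f v + ∑ vs (λ v → 0# ^ f v)
        ≈⟨ +-cong (reflexive (≡.cong (0# ^_) eq)) (∑-0^ f vs) ⟩
      1# + length (filter (λ v → f v ℕₚ.≟ 0) vs) · 1#
        ≡⟨ ≡.cong (λ l → length l · 1#) (Listₚ.filter-accept (λ v → f v ℕₚ.≟ 0) eq) ⟨
      length (filter (λ v → f v ℕₚ.≟ 0) (v ∷ vs)) · 1# ∎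
    head-value (suc m) eq = begin
      0# ^ f v + ∑ vs (λ v → 0# ^ f v)
        ≈⟨ +-cong (trans (reflexive (≡.cong (0# ^_) eq)) (zeroˡ _)) (∑-0^ f vs) ⟩
      0# + length (filter (λ v → f v ℕₚ.≟ 0) vs) · 1#
        ≈⟨ +-identityˡ _ ⟩
      length (filter (λ v → f v ℕₚ.≟ 0) vs) · 1#
        ≡⟨ ≡.cong (λ l → length l · 1#) (Listₚ.filter-reject (λ v → f v ℕₚ.≟ 0)
             (λ eq₀ → ℕₚ.1+n≢0 (≡.trans (≡.sym eq) eq₀))) ⟨
      length (filter (λ v → f v ℕₚ.≟ 0) (v ∷ vs)) · 1# ∎

  x≈1+[x-1] : ∀ x → x ≈ 1# + (x - 1#)
  x≈1+[x-1] x = begin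
    x                   ≈⟨ +-identityʳ x ⟨
    x + 0#              ≈⟨ +-congˡ (-‿inverseˡ 1#) ⟨
    x + (- 1# + 1#)     ≈⟨ +-assoc x (- 1#) 1# ⟨
    (x - 1#) + 1#       ≈⟨ +-comm (x - 1#) 1# ⟩
    1# + (x - 1#)       ∎

  1-x≈-[x-1] : ∀ x → 1# - x ≈ - (x - 1#)
  1-x≈-[x-1] x = begin
    1# - x              ≈⟨ +-comm 1# (- x) ⟩
    - x + 1#            ≈⟨ +-congˡ (-‿involutive 1#) ⟨
    - x + - - 1#        ≈⟨ -‿+-comm x (- 1#) ⟩
    - (x - 1#)          ∎

module _ where
  open ℤ using (+_)
  open Sums ℚₚ.+-*-commutativeRing
  open ≡.≡-Reasoning

  /-suc : ∀ a d .{{_ : NonZero d}} → + suc a ℚ./ d ≡ + 1 ℚ./ d ℚ.+ + a ℚ./ d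
  /-suc a (suc d) = ℚₚ.toℚᵘ-injective (begin-equality
    toℚᵘ (+ suc a ℚ./ suc d)
      ≃⟨ ℚₚ.toℚᵘ-fromℚᵘ (mkℚᵘ (+ suc a) d) ⟩
    mkℚᵘ (+ suc a) d
      ≃⟨ *≡* cross ⟩
    mkℚᵘ (+ 1) d ℚᵘ.+ mkℚᵘ (+ a) d
      ≃⟨ ℚᵘₚ.+-cong (ℚₚ.toℚᵘ-fromℚᵘ (mkℚᵘ (+ 1) d)) (ℚₚ.toℚᵘ-fromℚᵘ (mkℚᵘ (+ a) d)) ⟨
    toℚᵘ (+ 1 ℚ./ suc d) ℚᵘ.+ toℚᵘ (+ a ℚ./ suc d)
      ≃⟨ ℚₚ.toℚᵘ-homo-+ (+ 1 ℚ./ suc d) (+ a ℚ./ suc d) ⟨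
    toℚᵘ (+ 1 ℚ./ suc d ℚ.+ + a ℚ./ suc d) ∎ᵘ)
    where
    open ℚᵘₚ.≤-Reasoning using (begin-equality_; step-≃-⟩; step-≃-⟨) renaming (_∎ to _∎ᵘ)
    cross : + suc a ℤ.* (+ suc d ℤ.* + suc d) ≡
            (+ 1 ℤ.* + suc d ℤ.+ + a ℤ.* + suc d) ℤ.* + suc d
    cross = begin
      + suc a ℤ.* (+ suc d ℤ.* + suc d)  ≡⟨ ℤₚ.*-assoc (+ suc a) (+ suc d) (+ suc d) ⟨
      + suc a ℤ.* + suc d ℤ.* + suc d
        ≡⟨ ≡.cong (ℤ._* + suc d) (ℤₚ.*-distribʳ-+ (+ suc d) (+ 1) (+ a)) ⟩
      (+ 1 ℤ.* + suc d ℤ.+ + a ℤ.* + suc d) ℤ.* + suc d ∎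

  -- Here a · 1ℚ is the natural number a in ℚ.
  /-· : ∀ a d .{{_ : NonZero d}} → + a ℚ./ d ≡ + 1 ℚ./ d ℚ.* (a · 1ℚ)
  /-· zero    d = ≡.trans (ℚₚ.0/n≡0 d) (≡.sym (ℚₚ.*-zeroʳ (+ 1 ℚ./ d)))
  /-· (suc a) d = begin
    + suc a ℚ./ d                                       ≡⟨ /-suc a d ⟩
    + 1 ℚ./ d ℚ.+ + a ℚ./ d
      ≡⟨ ≡.cong₂ ℚ._+_ (≡.sym (ℚₚ.*-identityʳ (+ 1 ℚ./ d))) (/-· a d) ⟩
    + 1 ℚ./ d ℚ.* 1ℚ ℚ.+ + 1 ℚ./ d ℚ.* (a · 1ℚ)         ≡⟨ ℚₚ.*-distribˡ-+ (+ 1 ℚ./ d) 1ℚ (a · 1ℚ) ⟨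
    + 1 ℚ./ d ℚ.* (suc a · 1ℚ)                          ∎

  n/n≡1 : ∀ n .{{_ : NonZero n}} → + n ℚ./ n ≡ 1ℚ
  n/n≡1 (suc n) = ℚₚ.fromℚᵘ-cong {mkℚᵘ (+ suc n) n} {mkℚᵘ (+ 1) 0} (*≡* (ℤₚ.*-comm (+ suc n) (+ 1)))

  1/n!-inverse : ∀ n → 1 / n ! ℚ.* ((n !) · 1ℚ) ≡ 1ℚ
  1/n!-inverse n = ≡.trans (≡.sym (/-· (n !) (n !) {{n ℕₚ.!≢0}})) (n/n≡1 (n !) {{n ℕₚ.!≢0}})

module _ where
  open CommutativeRing ratRing
  open Sums ratRing
  open Fractions polyRing using (frac-/1-+; frac-/1-*)
  open Rat using (C)

  -- The embedding C of ℚ into ℚ(x) preserves sums and products.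
  C-+ : ∀ a b → C a + C b ≈ C (a ℚ.+ b)
  C-+ a b = frac-/1-+ (a ∷ []) (b ∷ [])

  C-* : ∀ a b → C a * C b ≈ C (a ℚ.* b)
  C-* a b = trans {C a * C b} {C (a ℚ.* b ℚ.+ 0ℚ)} {C (a ℚ.* b)}
    (frac-/1-* ((a ∷ []) Poly.* (b ∷ [])))
    (reflexive (≡.cong C (ℚₚ.+-identityʳ (a ℚ.* b))))

  module ℚ∑ = Sums ℚₚ.+-*-commutativeRing

  ·-C : ∀ n → n · 1# ≈ C (n ℚ∑.· 1ℚ)
  ·-C zero    = λ { zero → ≡.refl ; (suc i) → ≡.refl }
  ·-C (suc n) = trans {suc n · 1#} {1# + C (n ℚ∑.· 1ℚ)} {C (suc n ℚ∑.· 1ℚ)}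
    (+-cong {1#} {1#} {n · 1#} {C (n ℚ∑.· 1ℚ)} (refl {1#}) (·-C n)) (C-+ 1ℚ (n ℚ∑.· 1ℚ))

  C-1/n!-inverse : ∀ n → C (1 / n !) * ((n !) · 1#) ≈ 1#
  C-1/n!-inverse n = trans {w * ((n !) · 1#)} {w * C ((n !) ℚ∑.· 1ℚ)} {1#}
    (*-cong {w} {w} {(n !) · 1#} {C ((n !) ℚ∑.· 1ℚ)} (refl {w}) (·-C (n !)))
    (trans {w * C ((n !) ℚ∑.· 1ℚ)} {C (1 / n ! ℚ.* ((n !) ℚ∑.· 1ℚ))} {1#}
      (C-* (1 / n !) ((n !) ℚ∑.· 1ℚ)) (reflexive (≡.cong C (1/n!-inverse n))))
    where w = C (1 / n !)

-- The two generating functions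

corollary5 : (k : ℕ) → k ≥ 1 →
    (P : Array 2 k) → IsStandardTableau₂ P →
    head P ≡ tabulate (λ i → suc (toℕ i)) →
    (D P ℚ⟨x⟩⟦t⟧.≋
    ℚ⟨x⟩⟦t⟧.const (Rat.1# Rat.- Rat.X) ℚ⟨x⟩⟦t⟧.÷ D-denominator k [ 1-X-unit k ])
    ×
    (A P ℚ⟦t⟧.≋
    ℚ⟦t⟧.const 1ℚ ℚ⟦t⟧.÷ A-denominator k [ 1-unit k ])
corollary5 k@(suc _) _ P P-std P₀ = D-identity , A-identity
  where
  module D-identity where
    open CommutativeRing ratRing
    open Rat using (C; X)
    open Count ratRing P-std P₀ X (X - 1#) (x≈1+[x-1] ratRing X)
    open Evaluate (λ n → C (1 / n !)) C-1/n!-inverse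
    open import Algebra.Definitions.RawSemiring (RawRing.rawSemiring rawRing) using (_^_)

    -- The denominator lists its linear coefficient apart, with k ! in place of
    -- (k * 1) !.
    denominator-suc : ∀ n → D-denominator k (suc n) ≈
                      (X - 1#) ^ suc n * C (1 / (k ℕ.* suc n) !)
    denominator-suc zero    = *-cong {X - 1#} {(X - 1#) ^ 1} {C (1 / k !)} {C (1 / (k ℕ.* 1) !)}
      (sym {(X - 1#) ^ 1} {X - 1#} (*-identityʳ (X - 1#)))
      (reflexive (≡.cong (λ m → C (1 / m !)) (≡.sym (ℕₚ.*-identityʳ k))))
    denominator-suc (suc n) = refl {D-denominator k (suc (suc n))}

    values = quotient-value (D-denominator k) (1-X-unit k) (1-x≈-[x-1] ratRing X) denominator-suc

  D-identity : D P ℚ⟨x⟩⟦t⟧.≋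
    ℚ⟨x⟩⟦t⟧.const (Rat.1# Rat.- Rat.X) ℚ⟨x⟩⟦t⟧.÷ D-denominator k [ 1-X-unit k ]
  D-identity zero    = sym {q 0} {1#} (proj₁ D-identity.values)
    where
    open CommutativeRing ratRing
    q = ℚ⟨x⟩⟦t⟧.const (Rat.1# Rat.- Rat.X) ℚ⟨x⟩⟦t⟧.÷ D-denominator k [ 1-X-unit k ]
  D-identity (suc n) = proj₂ D-identity.values (suc n)

  module A-identity where
    open CommutativeRing ℚₚ.+-*-commutativeRing
    open Count ℚₚ.+-*-commutativeRing P-std P₀ 0ℚ (ℚ.- 1ℚ) ≡.refl
    open Evaluate (λ n → 1 / n !) 1/n!-inverse
    open import Algebra.Properties.Ring ring using (-1*x≈-x)
    open import Algebra.Definitions.RawSemiring (RawRing.rawSemiring rawRing) using (_^_)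

    denominator-suc : ∀ n → A-denominator k (suc n) ≡
                      (ℚ.- 1ℚ) ^ suc n ℚ.* (1 / (k ℕ.* suc n) !)
    denominator-suc zero    = ≡.trans (≡.sym (-1*x≈-x (1 / k !)))
      (≡.cong (λ m → (ℚ.- 1ℚ) ^ 1 ℚ.* (1 / m !)) (≡.sym (ℕₚ.*-identityʳ k)))
    denominator-suc (suc n) = ≡.refl

    values = quotient-value (A-denominator k) (1-unit k) ≡.refl denominator-suc

  A-identity : A P ℚ⟦t⟧.≋ ℚ⟦t⟧.const 1ℚ ℚ⟦t⟧.÷ A-denominator k [ 1-unit k ]
  A-identity zero    = ≡.sym (proj₁ A-identity.values)
  A-identity n@(suc _) = ≡.trans
    (≡.trans (/-· (#avoiding n P) ((k ℕ.* n) !) {{(k ℕ.* n) ℕₚ.!≢0}})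
      (≡.cong (1 / (k ℕ.* n) ! ℚ.*_) (≡.sym (∑-0^ ℚₚ.+-*-commutativeRing (mch P) (𝓕 n k)))))
    (proj₂ A-identity.values n)
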